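{- Let $n\geq 5$ and let $f\in F(n)$ have no fixed point. Then there exists $h\in F(n)$ with $h\sim f$ such that $\mathcal{A}(h)$ has an attractor $A$ of size at most $4$ and $\mathcal{A}(h)$ has an almost decreasing path from every configuration to $A$.
   Context: $F(n)$ is the set of all functions $f:\{0,1\}^n\to\{0,1\}^n$, written $f=(f_1,\dots,f_n)$. $e_i$ is the configuration with a $1$ exactly in component $i$; addition is componentwise modulo $2$. The asynchronous graph $\mathcal{A}(f)$ is the digraph on $\{0,1\}^n$ with an arc from $x$ to $x+e_i$ whenever $f_i(x)\neq x_i$. An attractor is an inclusion-minimal non-empty set $X\subseteq\{0,1\}^n$ with no arc from $X$ to its complement. $\leq$ is the componentwise order; an arc $x\to y$ is increasing if $x<y$ and decreasing otherwise; a path is almost decreasing if all its arcs except possibly one are decreasing. $\mathcal{S}(f)$ has an arc $x\to f(x)$; $f\sim h$ means $\mathcal{S}(f)$ and $\mathcal{S}(h)$ are isomorphic. -}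

module Defs where

open import Data.Nat using (ℕ)
open import Data.Bool using (Bool; true; false; not)
open import Data.Bool renaming (_≤_ to _≤ᵇ_)
open import Data.Fin using (Fin)
open import Data.Vec using (Vec; lookup; _[_]%=_)
open import Data.Product using (Σ; _×_; _,_; ∃)
open import Data.List using (List)
open import Data.List.Membership.Propositional using (_∈_)
open import Relation.Binary.PropositionalEquality using (_≡_; _≢_)
open import Relation.Nullary using (¬_)
open import Function.Bundles using (_↔_; Inverse)

Config : ℕ → Set
Config n = Vec Bool n

F : ℕ → Set
F n = Config n → Config n

flip : ∀ {n} → Config n → Fin n → Config n
flip x i = x [ i ]%= not

Arc : ∀ {n} → F n → Config n → Config n → Set
Arc f x y = Σ _ λ i → (lookup (f x) i ≢ lookup x i) × (y ≡ flip x i)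

_≤c_ : ∀ {n} → Config n → Config n → Set
x ≤c y = ∀ i → lookup x i ≤ᵇ lookup y i

_<c_ : ∀ {n} → Config n → Config n → Set
x <c y = (x ≤c y) × (x ≢ y)

DecArc : ∀ {n} → F n → Config n → Config n → Set
DecArc f x y = Arc f x y × ¬ (x <c y)

data DecPath {n} (f : F n) : Config n → Config n → Set where
  done : ∀ {x} → DecPath f x x
  step : ∀ {x y z} → DecArc f x y → DecPath f y z → DecPath f x z

data AlmostDecPath {n} (f : F n) (x z : Config n) : Set where
  allDec : DecPath f x z → AlmostDecPath f x z
  oneArc : ∀ {u v} → DecPath f x u → Arc f u v → DecPath f v z → AlmostDecPath f x z

Closed : ∀ {n} → F n → (Config n → Set) → Set
Closed f X = ∀ x y → X x → Arc f x y → X y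

IsAttractor : ∀ {n} → F n → List (Config n) → Set₁
IsAttractor {n} f A =
  (∃ λ x → x ∈ A)
  × Closed f (λ x → x ∈ A)
  × (∀ (Y : Config n → Set) → (∃ λ y → Y y) → (∀ y → Y y → y ∈ A)
       → Closed f Y → ∀ x → x ∈ A → Y x)

-- f ~ h : S(f) and S(h) isomorphic (bijection π with π (f x) = h (π x))
_∼_ : ∀ {n} → F n → F n → Set
_∼_ {n} f h = Σ (Config n ↔ Config n) λ π →
  ∀ x → Inverse.to π (f x) ≡ h (Inverse.to π x)

{-# OPTIONS --safe #-}
module Submission where

-- Label the elements by configurations ("positions") so that a small attractor sits near 0.
-- Outside it, it suffices that each position p either is not below the position h p of its
-- image, hence has a decreasing arc, or has an arc straight into the attractor.
--
-- List the positions in descending binary order. An image lying further down is harmless;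
-- an image lying higher up is harmless if the source is odd and the image is even, since
-- then bit 0 separates them. So the elements are assigned from the top down: positions are
-- filled by elements without unassigned preimages (leaves) as long as there are any, and when
-- the unassigned elements are permuted by f, a cycle is cut by putting one of its elements
-- at an even position. Its preimage then becomes an "orphan" that must end at an odd
-- position; each pair of an even and the next odd position leaves at most one orphan pending.
--
-- The attractor comes from a 2-cycle; or from a fork f x = f y = c, with x and y adjacent to c
-- and f c at the fourth corner of their square; or, when f is a permutation, from a 4-cycle on
-- a square or from two disjoint paths x → c → z and y → d → w. The top position
-- is above everything, so it receives a leaf, or else an element whose only preimage is at 0.

open import Defs
open import Data.Nat using (ℕ; _≤_; zero; suc; _+_; _<_; z≤n; s≤s; s≤s⁻¹)
open import Data.Nat.Properties
  using (≤-total; ≤-reflexive; ≤-refl; ≤-trans; ≤-<-trans; <⇒≱; n<1+n; m≤m+n; m≤n+m; m≤n⇒∃[o]m+o≡n;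
         suc-injective; +-suc; +-cancelʳ-≡; +-monoˡ-<)
open import Data.Bool using (Bool; true; false; not; _∧_; _xor_; if_then_else_)
import Data.Bool as Bool
open import Data.Fin using (Fin; zero; suc)
open import Data.Vec using (Vec; []; _∷_; lookup; replicate) renaming (_++_ to _++ᵛ_)
open import Data.Vec.Properties using (≡-dec; lookup∘updateAt; lookup-replicate)
open import Data.Product using (Σ; _×_; _,_; ∃; proj₁; proj₂)
open import Data.Sum using (_⊎_; inj₁; inj₂)
open import Data.List using (List; length; []; _∷_; _++_; map; filter; take; drop; applyUpTo)
open import Data.List.Properties
  using (length-map; length-++; map-++; ++-assoc; ++-identityʳ; take++drop≡id)
open import Data.List.Membership.Propositional using (_∈_; _∉_; find; lose)
open import Data.List.Membership.Propositional.Properties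
  using (∈-∃++; ∈-map⁺; ∈-map⁻; ∈-++⁺ˡ; ∈-++⁺ʳ; ∈-++⁻; ∈-filter⁺; ∈-filter⁻; ∈-applyUpTo⁺; ∈-applyUpTo⁻;
         ∈-AllPairs₂)
import Data.List.Membership.DecPropositional as DecMembership
open import Data.List.Relation.Unary.Any using (here; there; any?)
open import Data.List.Relation.Unary.All using (All; []; _∷_)
import Data.List.Relation.Unary.All as All
import Data.List.Relation.Unary.All.Properties as All
open import Data.List.Relation.Unary.AllPairs using (AllPairs; []; _∷_)
import Data.List.Relation.Unary.AllPairs as AllPairs
import Data.List.Relation.Unary.AllPairs.Properties as AllPairs
open import Data.List.Relation.Unary.Linked using (Linked; [-]; _∷_)
open import Data.List.Relation.Unary.Unique.Propositional using (Unique)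
open import Data.List.Relation.Unary.Unique.Propositional.Properties as Unique
  using (Unique[x∷xs]⇒x∉xs; filter⁺; applyUpTo⁺₁)
open import Data.List.Relation.Binary.Permutation.Propositional
  using (_↭_; prep; swap; ↭-refl; ↭-sym; ↭-trans; ↭-reflexive; ↭⇒↭ₛ)
open import Data.List.Relation.Binary.Permutation.Propositional.Properties
  using (∈-resp-↭; ↭-length; ++⁺ˡ; ++⁺ʳ; ++-comm; shift; shifts)
import Data.List.Relation.Binary.Permutation.Setoid.Properties as ↭ₛ
open import Function using (case_of_)
open import Function.Bundles using (_↔_; mk↔ₛ′)
open import Relation.Binary using (DecidableEquality)
open import Relation.Binary.PropositionalEquality
  using (_≡_; _≢_; refl; sym; trans; cong; subst; setoid; ≢-sym)
open import Relation.Nullary using (¬_; Dec; yes; no; ¬?; _×-dec_; contradiction)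
open import Relation.Nullary.Decidable using (decidable-stable)

private variable
  A : Set
  xs ys : List A
  n m : ℕ

-- Lists without repetitions, up to permutation.

extract : ∀ {x : A} {xs} → x ∈ xs → ∃ λ ys → xs ↭ x ∷ ys
extract x∈xs with ys , zs , refl ← ∈-∃++ x∈xs = ys ++ zs , shift _ ys zs

Unique-resp-↭ : xs ↭ ys → Unique xs → Unique ys
Unique-resp-↭ {A} p = ↭ₛ.Unique-resp-↭ (setoid A) (↭⇒↭ₛ p)

tail-∈ : ∀ {x y : A} {xs} → y ∈ x ∷ xs → y ≢ x → y ∈ xs
tail-∈ (here y≡x)   y≢x = contradiction y≡x y≢x
tail-∈ (there y∈xs) _   = y∈xs

Unique-∷⁻ : ∀ {x : A} {xs} → Unique (x ∷ xs) → Unique xs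
Unique-∷⁻ (_ ∷ u) = u

-- Pigeonhole: each element of `xs` uses up its own element of `ys`, and the length bound leaves
-- none over.
⊆-Unique⇒↭ : Unique xs → (∀ {x} → x ∈ xs → x ∈ ys) →
             length ys ≤ length xs → xs ↭ ys
⊆-Unique⇒↭ {xs = []} {ys = []}     _ _ _  = ↭-refl
⊆-Unique⇒↭ {xs = []} {ys = _ ∷ _}  _ _ ()
⊆-Unique⇒↭ {xs = x ∷ xs} u@(_ ∷ u′) sub le with ys′ , p ← extract (sub (here refl)) =
  ↭-trans (prep x (⊆-Unique⇒↭ u′ sub′ le′)) (↭-sym p)
  where
  sub′ : ∀ {y} → y ∈ xs → y ∈ ys′
  sub′ y∈xs = tail-∈ (∈-resp-↭ p (sub (there y∈xs)))
                     λ { refl → Unique[x∷xs]⇒x∉xs u y∈xs }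
  le′ : length ys′ ≤ length xs
  le′ = s≤s⁻¹ (subst (_≤ suc (length xs)) (↭-length p) le)

⊆-Unique⇒length≤ : Unique xs → (∀ {x} → x ∈ xs → x ∈ ys) → length xs ≤ length ys
⊆-Unique⇒length≤ {xs = xs} {ys} u sub with ≤-total (length xs) (length ys)
... | inj₁ le = le
... | inj₂ ge = ≤-reflexive (↭-length (⊆-Unique⇒↭ u sub ge))

Unique-map⁻-injective : ∀ {B : Set} (f : A → B) {x y xs} → Unique (map f xs) →
                        x ∈ xs → y ∈ xs → f x ≡ f y → x ≡ y
Unique-map⁻-injective f u x∈ y∈ eq with ∈-AllPairs₂ (AllPairs.map⁻ u) x∈ y∈
... | inj₁ x≡y        = x≡y
... | inj₂ (inj₁ neq) = contradiction eq neq
... | inj₂ (inj₂ neq) = contradiction (sym eq) neq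

Unique-map⁺ : ∀ {B : Set} {f : A → B} → (∀ {x y} → x ∈ xs → y ∈ xs → f x ≡ f y → x ≡ y) →
              Unique xs → Unique (map f xs)
Unique-map⁺ inj []           = []
Unique-map⁺ inj u@(_ ∷ u′) =
  All.map⁺ (All.tabulate λ y∈ eq →
    Unique[x∷xs]⇒x∉xs u (subst (_∈ _) (sym (inj (here refl) (there y∈) eq)) y∈))
  ∷ Unique-map⁺ (λ x∈ y∈ → inj (there x∈) (there y∈)) u′

-- Top-down placement of elements on positions.

module Place {V P : Set} (_≟_ : DecidableEquality V) (f : V → V) (f-nofix : ∀ x → f x ≢ x)
             (Even Odd : P → Set) where

  open DecMembership _≟_ using (_∈?_)

  Covers : List V → List V → Set
  Covers R C = ∀ {x} → x ∈ C → ∃ λ e → e ∈ R × f e ≡ x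

  Leaf : List V → V → Set
  Leaf R x = ∀ {e} → e ∈ R → f e ≢ x

  leaf-or-covers : ∀ R C → (∃ λ x → x ∈ C × Leaf R x) ⊎ Covers R C
  leaf-or-covers R []      = inj₂ λ ()
  leaf-or-covers R (x ∷ C) with any? (λ e → f e ≟ x) R
  ... | no ¬pre = inj₁ (x , here refl , λ e∈ eq → ¬pre (lose e∈ eq))
  ... | yes pre with leaf-or-covers R C
  ...   | inj₁ (y , y∈ , leaf) = inj₁ (y , there y∈ , leaf)
  ...   | inj₂ cov = inj₂ λ { (here refl) → find pre ; (there y∈) → cov y∈ }

  module _ {R : List V} (u : Unique R) (cov : Covers R R) where

    private
      -- `R` is contained in `map f R`, which is equally long, so pigeonhole applies; closure and
      -- injectivity both follow.
      R↭fR : R ↭ map f R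
      R↭fR = ⊆-Unique⇒↭ u (λ x∈ → let e , e∈ , eq = cov x∈ in subst (_∈ map f R) eq (∈-map⁺ f e∈))
                        (≤-reflexive (length-map f R))

    covers⇒closed : ∀ {e} → e ∈ R → f e ∈ R
    covers⇒closed e∈ = ∈-resp-↭ (↭-sym R↭fR) (∈-map⁺ f e∈)

    covers⇒injective : ∀ {e e′} → e ∈ R → e′ ∈ R → f e ≡ f e′ → e ≡ e′
    covers⇒injective = Unique-map⁻-injective f (Unique-resp-↭ R↭fR u)

  injective⇒covers : ∀ {R} → Unique R → (∀ {e} → e ∈ R → f e ∈ R) →
                     (∀ {e e′} → e ∈ R → e′ ∈ R → f e ≡ f e′ → e ≡ e′) → Covers R R
  injective⇒covers {R} u closed inj x∈ =
    let e , e∈ , eq = ∈-map⁻ f (∈-resp-↭ (↭-sym fR↭R) x∈) in e , e∈ , sym eq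
    where
    fR↭R : map f R ↭ R
    fR↭R = ⊆-Unique⇒↭ (Unique-map⁺ inj u)
             (λ m → let e , e∈ , eq = ∈-map⁻ f m in subst (_∈ R) (sym eq) (closed e∈))
             (≤-reflexive (sym (length-map f R)))

  -- The first pair is the higher one. Only an element whose image lies above it needs care; there
  -- bit 0, set below and clear above, gives the decreasing arc.
  Good : P × V → P × V → Set
  Good (p , e) (p′ , e′) = f e′ ≡ e → Even p × Odd p′

  record Placement (ps : List P) (R : List V) (o : V) : Set where
    constructor placement
    field
      pairs     : List (P × V)
      positions : map proj₁ pairs ≡ ps
      elements  : map proj₂ pairs ↭ R
      good      : AllPairs Good pairs
      orphan    : ∀ {p} → (p , o) ∈ pairs → Odd p

    element-∈ : ∀ {p e} → (p , e) ∈ pairs → e ∈ R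
    element-∈ m = ∈-resp-↭ elements (∈-map⁺ proj₂ m)

    position-of : ∀ {e} → e ∈ R → ∃ λ p → (p , e) ∈ pairs
    position-of e∈ with (p , _) , m , refl ← ∈-map⁻ proj₂ (∈-resp-↭ (↭-sym elements) e∈) = p , m

  open Placement

  -- The image of the orphan o has already been put on an even position above
  -- ps, so o itself must go to an odd position; o ∉ R means there is no orphan.
  Solvable : List P → Set
  Solvable ps = ∀ R o → Unique R → length R ≡ length ps → (o ∈ R → f o ∉ R) →
                Placement ps R o

  place : ∀ {ps R R′ o o′} p e → R ↭ e ∷ R′ → (π : Placement ps R′ o′) →
          (∀ {p′ e′} → (p′ , e′) ∈ pairs π → f e′ ≡ e → Even p × Odd p′) →
          (e ≡ o → Odd p) → (∀ {p′} → (p′ , o) ∈ pairs π → Odd p′) →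
          Placement (p ∷ ps) R o
  place p e R↭ π pre eo oo = placement
    ((p , e) ∷ pairs π)
    (cong (p ∷_) (positions π))
    (↭-trans (prep e (elements π)) (↭-sym R↭))
    (All.tabulate (λ {(p′ , e′)} m → pre m) ∷ good π)
    λ { (here refl) → eo refl ; (there m) → oo m }

  private
    rest-length : ∀ {k R R′} {e : V} → R ↭ e ∷ R′ → length R ≡ suc k → length R′ ≡ k
    rest-length p eq = suc-injective (trans (sym (↭-length p)) eq)

    rest-unique : ∀ {R R′} {e : V} → R ↭ e ∷ R′ → Unique R → Unique R′
    rest-unique p u = Unique-∷⁻ (Unique-resp-↭ p u)

    ∉-rest : ∀ {R R′} {e : V} → R ↭ e ∷ R′ → Unique R → e ∉ R′
    ∉-rest p u = Unique[x∷xs]⇒x∉xs (Unique-resp-↭ p u)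

    rest-⊆ : ∀ {R R′} {e e′ : V} → R ↭ e ∷ R′ → e′ ∈ R′ → e′ ∈ R
    rest-⊆ p e∈ = ∈-resp-↭ (↭-sym p) (there e∈)

    rest-covers : ∀ {R R′ o} → R ↭ o ∷ R′ → f o ∉ R → Covers R R′ → Covers R′ R′
    rest-covers p fo∉ cov x∈ with e , e∈ , eq ← cov x∈ =
      e , tail-∈ (∈-resp-↭ p e∈) (λ { refl → fo∉ (subst (_∈ _) (sym eq) (rest-⊆ p x∈)) }) , eq

  -- An odd position creates no new orphan. A leaf other than `o` may take it while `o` stays
  -- pending; if there is none, the rest is permuted by `f`, so `o` is itself a leaf and takes it.
  place-odd : ∀ {ps d} → Solvable ps → Odd d → ∀ R o → Unique R → length R ≡ suc (length ps) →
              o ∈ R → f o ∉ R → Placement (d ∷ ps) R o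
  place-odd {d = d} solve odd R o u len o∈ fo∉ with R₁ , R↭ ← extract o∈ with leaf-or-covers R R₁
  ... | inj₁ (x , x∈ , leaf) with R₂ , R↭₂ ← extract (rest-⊆ R↭ x∈) =
    place d x R↭₂ π (λ m eq → contradiction eq (leaf (rest-⊆ R↭₂ (element-∈ π m))))
          (λ _ → odd) (orphan π)
    where π = solve R₂ o (rest-unique R↭₂ u) (rest-length R↭₂ len)
                    (λ _ fo∈ → fo∉ (rest-⊆ R↭₂ fo∈))
  ... | inj₂ cov =
    place d o R↭ π (λ { m refl → contradiction (covers⇒closed u₁ cov₁ (element-∈ π m)) (∉-rest R↭ u) })
          (λ _ → odd) (orphan π)
    where
    u₁   = rest-unique R↭ u
    cov₁ = rest-covers R↭ fo∉ cov
    π    = solve R₁ o u₁ (rest-length R↭ len) (λ o∈₁ → contradiction o∈₁ (∉-rest R↭ u))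

  -- Some `w` of the permuted set `R₁` goes to the even position and `ℓ` to the odd one. Nothing
  -- left maps to `ℓ`, because `f` keeps `R₁` within itself, and the only preimage of `w` in `R₁`
  -- becomes the new orphan.
  place-break : ∀ {ps e d} → Solvable ps → Even e → Odd d → ∀ {R R₁ ℓ} o →
                R ↭ ℓ ∷ R₁ → Unique R → length R ≡ suc (suc (length ps)) →
                Covers R₁ R₁ → (o ∈ R → o ≡ ℓ) → Placement (e ∷ d ∷ ps) R o
  place-break solve even odd {R₁ = []} o R↭ u len cov _ with () ← rest-length R↭ len
  place-break {e = e} {d} solve even odd {R} {w ∷ R₂} {ℓ} o R↭ u len cov o≡ℓ =
    place e w (↭-trans R↭ (swap ℓ w ↭-refl)) π₁ pre
          (λ { refl → contradiction (o≡ℓ (rest-⊆ R↭ (here refl))) λ { refl → ℓ∉ (here refl) } })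
          λ { (here refl) → odd
            ; (there m) → contradiction (there (element-∈ π m))
                (subst (_∉ w ∷ R₂) (sym (o≡ℓ (rest-⊆ R↭ (there (element-∈ π m))))) ℓ∉) }
    where
    u₁ = rest-unique R↭ u
    ℓ∉ = ∉-rest R↭ u
    w∉ = Unique[x∷xs]⇒x∉xs u₁
    p  = proj₁ (cov (here refl))
    p∈ = proj₁ (proj₂ (cov (here refl)))
    fp : f p ≡ w
    fp = proj₂ (proj₂ (cov (here refl)))
    π  = solve R₂ p (Unique-∷⁻ u₁) (suc-injective (rest-length R↭ len))
               (λ _ fp∈ → w∉ (subst (_∈ R₂) fp fp∈))
    π₁ : Placement (d ∷ _) (ℓ ∷ R₂) p
    π₁ = place d ℓ ↭-refl π
           (λ { m refl → contradiction (covers⇒closed u₁ cov (there (element-∈ π m))) ℓ∉ })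
           (λ _ → odd) (orphan π)
    pre : ∀ {p′ e′} → (p′ , e′) ∈ pairs π₁ → f e′ ≡ w → Even e × Odd p′
    pre (here refl) _  = even , odd
    pre (there m)   eq with refl ← covers⇒injective u₁ cov (there (element-∈ π m)) p∈ (trans eq (sym fp)) =
      even , orphan π m

  solvable-[] : Solvable []
  solvable-[] []      o _ _  _ = placement [] refl ↭-refl [] λ ()
  solvable-[] (_ ∷ _) o _ ()

  solvable-[_] : ∀ {d} → Odd d → Solvable (d ∷ [])
  solvable-[_]     odd (x ∷ [])    o _ _  _ =
    placement ((_ , x) ∷ []) refl ↭-refl ([] ∷ []) λ { (here refl) → odd }
  solvable-[ odd ] []          o _ ()
  solvable-[ odd ] (_ ∷ _ ∷ _) o _ ()

  -- The even position takes a leaf if a suitable one exists. Otherwise what remains, apart from an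
  -- orphan or a single leaf, is permuted by `f`, and a cycle is broken at the even position. The
  -- odd position goes to a leaf or an orphan, so at most one orphan is passed on.
  solvable-pair : ∀ {ps e d} → Even e → Odd d → Solvable ps → Solvable (e ∷ d ∷ ps)
  solvable-pair {e = e} {d} even odd solve R o u len fo∉ with o ∈? R
  solvable-pair {e = e} {d} even odd solve R o u len fo∉ | yes o∈ with R₁ , R↭ ← extract o∈ with leaf-or-covers R R₁
  ... | inj₁ (w , w∈ , leaf) with R₂ , R↭₂ ← extract (rest-⊆ R↭ w∈) =
    place e w R↭₂ π (λ m eq → contradiction eq (leaf (rest-⊆ R↭₂ (element-∈ π m))))
          (λ w≡o → contradiction w≡o w≢o) (orphan π)
    where
    w≢o : w ≢ o
    w≢o refl = ∉-rest R↭ u w∈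
    π = place-odd solve odd R₂ o (rest-unique R↭₂ u) (rest-length R↭₂ len)
                  (tail-∈ (∈-resp-↭ R↭₂ o∈) λ o≡w → w≢o (sym o≡w))
                  (λ fo∈ → fo∉ o∈ (rest-⊆ R↭₂ fo∈))
  ... | inj₂ cov =
    place-break solve even odd o R↭ u len (rest-covers R↭ (fo∉ o∈) cov) (λ _ → refl)
  solvable-pair {e = e} {d} even odd solve R o u len fo∉ | no o∉ with leaf-or-covers R R
  ... | inj₁ (ℓ , ℓ∈ , leaf) with R₁ , R↭ ← extract ℓ∈ with leaf-or-covers R₁ R₁
  ...   | inj₁ (ℓ′ , ℓ′∈ , leaf′) with R₂ , R↭₂ ← extract ℓ′∈ =
    place e ℓ R↭ π₁ (λ m eq → contradiction eq (leaf (rest-⊆ R↭ (element-∈ π₁ m))))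
          (λ { refl → contradiction ℓ∈ o∉ })
          (λ m → contradiction (rest-⊆ R↭ (element-∈ π₁ m)) o∉)
    where
    u₁ = rest-unique R↭ u
    -- `ℓ′` is not in `R₂`, so naming it as the orphan means that none is pending.
    π  = solve R₂ ℓ′ (rest-unique R↭₂ u₁) (rest-length R↭₂ (rest-length R↭ len))
               (λ ℓ′∈₂ → contradiction ℓ′∈₂ (∉-rest R↭₂ u₁))
    π₁ : Placement (d ∷ _) R₁ ℓ′
    π₁ = place d ℓ′ R↭₂ π (λ m eq → contradiction eq (leaf′ (rest-⊆ R↭₂ (element-∈ π m))))
               (λ _ → odd) (orphan π)
  ...   | inj₂ cov = place-break solve even odd o R↭ u len cov (λ o∈ → contradiction o∈ o∉)
  solvable-pair even odd solve [] o u () fo∉ | no o∉ | inj₂ cov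
  solvable-pair {e = e} {d} even odd solve (w ∷ R₁) o u len fo∉ | no o∉ | inj₂ cov
    with p , p∈ , fp ← cov (here refl) =
    place e w ↭-refl π pre (λ { refl → contradiction (here refl) o∉ })
          (λ m → contradiction (there (element-∈ π m)) o∉)
    where
    w∉ = Unique[x∷xs]⇒x∉xs u
    π : Placement (d ∷ _) R₁ p
    π = place-odd solve odd R₁ p (Unique-∷⁻ u) (suc-injective len)
          (tail-∈ p∈ λ { refl → f-nofix w fp })
          (λ fp∈ → w∉ (subst (_∈ R₁) fp fp∈))
    pre : ∀ {p′ e′} → (p′ , e′) ∈ pairs π → f e′ ≡ w → Even e × Odd p′
    pre m eq with refl ← covers⇒injective u cov (there (element-∈ π m)) p∈ (trans eq (sym fp)) =
      even , orphan π m

  Topological : List V → Set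
  Topological = AllPairs λ e e′ → f e′ ≢ e

  -- By pigeonhole `f` permutes `C`: a core is a non-empty union of cycles inside `S`.
  Core : List V → Set
  Core S = ∃ λ C → Unique C × (∃ λ w → w ∈ C) × (∀ {x} → x ∈ C → x ∈ S) × Covers C C

  -- Leaves are stripped one by one, each being the image of nothing that remains. Stripping can
  -- only get stuck at a set that covers itself.
  sort-or-core : ∀ k S → length S ≡ k → Unique S →
                 (∃ λ L → S ↭ L × Topological L) ⊎ Core S
  sort-or-core k       []      _   _ = inj₁ ([] , ↭-refl , [])
  sort-or-core (suc k) S@(s ∷ _) len u with leaf-or-covers S S
  ... | inj₂ cov = inj₂ (S , u , (s , here refl) , (λ x∈ → x∈) , cov)
  ... | inj₁ (x , x∈ , leaf) with S′ , S↭ ← extract x∈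
    with sort-or-core k S′ (rest-length S↭ len) (rest-unique S↭ u)
  ...   | inj₁ (L , S′↭ , topo) =
    inj₁ (x ∷ L , ↭-trans S↭ (prep x S′↭)
         , All.tabulate (λ e∈ → leaf (rest-⊆ S↭ (∈-resp-↭ (↭-sym S′↭) e∈))) ∷ topo)
  ...   | inj₂ (C , uC , w , C⊆ , cov) = inj₂ (C , uC , w , (λ x∈ → rest-⊆ S↭ (C⊆ x∈)) , cov)

  -- In topological order every image within the list comes later, so nothing maps upward and odd
  -- positions suffice.
  place-sorted : ∀ {ds} L o → All Odd ds → Topological L → length L ≡ length ds →
                 ∃ λ (π : Placement ds L o) → ∀ {p e} → (p , e) ∈ pairs π → Odd p
  place-sorted []      o []           _            _   =
    placement [] refl ↭-refl [] (λ ()) , λ ()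
  place-sorted (x ∷ L) o (odd ∷ odds) (leaf ∷ topo) len =
    let π , all-odd = place-sorted L o odds topo (suc-injective len) in
    place _ x ↭-refl π (λ m eq → contradiction eq (All.lookup leaf (element-∈ π m)))
          (λ _ → odd) (orphan π)
    , λ { (here refl) → odd ; (there m) → all-odd m }

  module _ (f-no2 : ∀ x → f (f x) ≢ x) where

    private
      module _ {R C C′ : List V} {w : V}
        (uC : Unique C) (C⊆R : ∀ {x} → x ∈ C → x ∈ R) (cov : Covers C C)
        (uC′ : Unique C′) (C′⊆R : ∀ {x} → x ∈ C′ → x ∈ R) (cov′ : Covers C′ C′) where

        closed  = covers⇒closed uC cov
        closed′ = covers⇒closed uC′ cov′

        I = filter (_∈? C′) C

        I-covers : Covers I I
        I-covers = injective⇒covers (filter⁺ (_∈? C′) uC)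
          (λ e∈ → let e∈C , e∈C′ = ∈-filter⁻ (_∈? C′) {xs = C} e∈ in
                  ∈-filter⁺ (_∈? C′) (closed e∈C) (closed′ e∈C′))
          (λ e∈ e′∈ → covers⇒injective uC cov (proj₁ (∈-filter⁻ (_∈? C′) {xs = C} e∈))
                                              (proj₁ (∈-filter⁻ (_∈? C′) {xs = C} e′∈)))

        -- Both cores are closed, so `f` permutes their intersection `I`. If `f a` were in `I`, its
        -- preimage there would be `a`, by injectivity on `C`.
        stays-out : ∀ {a} → a ∈ C → a ∉ C′ → f a ∉ C′
        stays-out a∈ a∉ fa∈ with i , i∈ , eq ← I-covers (∈-filter⁺ (_∈? C′) (closed a∈) fa∈)
          with i∈C , i∈C′ ← ∈-filter⁻ (_∈? C′) {xs = C} i∈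
          with refl ← covers⇒injective uC cov i∈C a∈ eq = a∉ i∈C′

        -- Each core contains a cycle of length at least three.
        six≤ : w ∈ C → w ∉ C′ → (∃ λ v → v ∈ C′) → 6 ≤ length R
        six≤ w∈ w∉ (v , v∈) = ⊆-Unique⇒length≤ unique (All.lookup members)
          where
          six = w ∷ f w ∷ f (f w) ∷ v ∷ f v ∷ f (f v) ∷ []
          members : All (_∈ R) six
          members = C⊆R w∈ ∷ C⊆R (closed w∈) ∷ C⊆R (closed (closed w∈))
                  ∷ C′⊆R v∈ ∷ C′⊆R (closed′ v∈) ∷ C′⊆R (closed′ (closed′ v∈)) ∷ []
          apart : ∀ {a} → a ∉ C′ → All (a ≢_) (v ∷ f v ∷ f (f v) ∷ [])
          apart a∉ = (λ { refl → a∉ v∈ }) ∷ (λ { refl → a∉ (closed′ v∈) })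
                   ∷ (λ { refl → a∉ (closed′ (closed′ v∈)) }) ∷ []
          fw∉  = stays-out w∈ w∉
          ffw∉ = stays-out (closed w∈) fw∉
          unique : Unique six
          unique = (≢-sym (f-nofix w) ∷ ≢-sym (f-no2 w) ∷ apart w∉)
                 ∷ (≢-sym (f-nofix (f w)) ∷ apart fw∉)
                 ∷ apart ffw∉
                 ∷ (≢-sym (f-nofix v) ∷ ≢-sym (f-no2 v) ∷ [])
                 ∷ (≢-sym (f-nofix (f v)) ∷ [])
                 ∷ [] ∷ []

    -- A core of five elements is a single cycle, so one even position breaks it.
    solvable-five : ∀ {e ds} → Even e → All Odd ds → length ds ≡ 4 → Solvable (e ∷ ds)
    solvable-five {e} even odds len-ds R o u len fo∉ with sort-or-core _ R refl u
    ... | inj₁ ([] , R↭ , topo) = contradiction (trans (sym (↭-length R↭)) len) λ ()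
    ... | inj₁ (x ∷ [] , R↭ , topo) =
      contradiction (trans (trans (sym (↭-length R↭)) len) (cong suc len-ds)) λ ()
    ... | inj₁ (x ∷ y ∷ L , R↭ , leafx ∷ leafy ∷ topo) with x ≟ o
    ...   | no x≢o =
      let π , _ = place-sorted (y ∷ L) o odds (leafy ∷ topo) (rest-length R↭ len) in
      place e x R↭ π (λ m eq → contradiction eq (All.lookup leafx (element-∈ π m)))
            (λ x≡o → contradiction x≡o x≢o) (orphan π)
    -- The orphan `x` may not take the even position. As `f x` lies outside `R`, `y` is a leaf as
    -- well, and the two change places.
    ...   | yes refl =
      let π , _ = place-sorted (x ∷ L) o odds (All.tail leafx ∷ topo) (rest-length R↭ len) in
      place e y (↭-trans R↭ (swap x y ↭-refl)) π
            (λ m eq → contradiction eq (leaf (element-∈ π m)))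
            (λ { refl → contradiction (here refl) (∉-rest R↭ u) }) (orphan π)
      where
      leaf : ∀ {e′} → e′ ∈ x ∷ L → f e′ ≢ y
      leaf (here refl) eq = fo∉ (∈-resp-↭ (↭-sym R↭) (here refl))
                                (∈-resp-↭ (↭-sym R↭) (there (here eq)))
      leaf (there e∈)     = All.lookup leafy e∈
    solvable-five {e} even odds len-ds R o u len fo∉ | inj₂ (C , uC , (w , w∈) , C⊆ , cov)
      with S , R↭ ← extract (C⊆ w∈) with sort-or-core _ S refl (rest-unique R↭ u)
    -- `C′` misses `w`, so the two cores would supply six elements where only five are left.
    ... | inj₂ (C′ , uC′ , v , C′⊆ , cov′) = contradiction
      (six≤ uC C⊆ cov uC′ (λ x∈ → rest-⊆ R↭ (C′⊆ x∈)) cov′ w∈ (λ w∈′ → ∉-rest R↭ u (C′⊆ w∈′)) v)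
      (subst (λ k → ¬ 6 ≤ k) (sym (trans len (cong suc len-ds))) (<⇒≱ (n<1+n 5)))
    -- Without `w` the rest is acyclic and fits the odd positions in sorted order; preimages of `w`
    -- are then separated from it by bit 0. The orphan is not `w`, since `f w` stays in the core.
    ... | inj₁ (L , S↭ , topo) =
      let R↭′       = ↭-trans R↭ (prep w S↭)
          π , all-odd = place-sorted L o odds topo (rest-length R↭′ len) in
      place e w R↭′ π (λ m _ → even , all-odd m)
            (λ { refl → contradiction (C⊆ (covers⇒closed uC cov w∈)) (fo∉ (C⊆ w∈)) })
            (orphan π)

-- The cube in descending binary order.

Dn : Config n → Config n → Set
Dn p q = ∃ λ i → lookup p i ≡ true × lookup q i ≡ false

double : List (Config n) → List (Config (suc n))
double []       = []
double (v ∷ vs) = (true ∷ v) ∷ (false ∷ v) ∷ double vs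

-- Descending binary order, the head being the least significant bit.
cube : ∀ n → List (Config n)
cube zero    = [] ∷ []
cube (suc n) = double (cube n)

double-∈ : ∀ b {v : Config n} {vs} → v ∈ vs → (b ∷ v) ∈ double vs
double-∈ true  (here refl) = here refl
double-∈ false (here refl) = there (here refl)
double-∈ b     (there v∈)  = there (there (double-∈ b v∈))

cube-complete : (p : Config n) → p ∈ cube n
cube-complete []      = here refl
cube-complete (b ∷ p) = double-∈ b (cube-complete p)

double-++ : (vs ws : List (Config n)) → double (vs ++ ws) ≡ double vs ++ double ws
double-++ []       ws = refl
double-++ (v ∷ vs) ws = cong (λ l → (true ∷ v) ∷ (false ∷ v) ∷ l) (double-++ vs ws)

Dn-∷ : ∀ {a b} {p q : Config n} → Dn p q → Dn (a ∷ p) (b ∷ q)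
Dn-∷ (i , pi , qi) = suc i , pi , qi

-- Inside a new pair bit 0 separates; between pairs the bit found one dimension lower does, shifted
-- by one.
double-Dn : {vs : List (Config n)} → AllPairs Dn vs → AllPairs Dn (double vs)
double-Dn []         = []
double-Dn (dn ∷ dns) = ((zero , refl , refl) ∷ below dn) ∷ below dn ∷ double-Dn dns
  where
  below : ∀ {b v vs} → All (Dn v) vs → All (Dn (b ∷ v)) (double {n} vs)
  below []       = []
  below (d ∷ ds) = Dn-∷ d ∷ Dn-∷ d ∷ below ds

cube-Dn : ∀ n → AllPairs Dn (cube n)
cube-Dn zero    = [] ∷ []
cube-Dn (suc n) = double-Dn (cube-Dn n)

Dn⇒≢ : {p q : Config n} → Dn p q → p ≢ q
Dn⇒≢ (i , pi , qi) refl with () ← trans (sym pi) qi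

cube-Unique : ∀ n → Unique (cube n)
cube-Unique n = AllPairs.map Dn⇒≢ (cube-Dn n)

-- Attractors and almost decreasing paths.

weight : Config n → ℕ
weight []          = zero
weight (true ∷ p)  = suc (weight p)
weight (false ∷ p) = weight p

weight-flip : (p : Config n) (i : Fin n) → lookup p i ≡ true → weight p ≡ suc (weight (flip p i))
weight-flip (true ∷ p)  zero    _  = refl
weight-flip (true ∷ p)  (suc i) pi = cong suc (weight-flip p i pi)
weight-flip (false ∷ p) (suc i) pi = weight-flip p i pi

module Attract (h : F n) where

  _⇄_ : Config n → Config n → Set
  p ⇄ q = Arc h p q × Arc h q p

  Fine : List (Config n) → Config n → Set
  Fine A p = p ∈ A ⊎ Dn p (h p) ⊎ ∃ λ v → v ∈ A × Arc h p v

  arc : ∀ {p q} → h p ≡ q → ∀ i → lookup q i ≢ lookup p i → Arc h p (flip p i)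
  arc refl i neq = i , neq , refl

  -- A bit set in `p` and clear in `h p` is one that a decreasing arc from `p` can flip.
  Dn-arc : ∀ {p} ((i , _) : Dn p (h p)) → DecArc h p (flip p i)
  Dn-arc {p} (i , pi , qi) =
    (i , (λ eq → case (trans (sym qi) (trans eq pi))) , refl) , λ (le , _) → down (le i)
    where
    case : false ≢ true
    case ()
    down : ¬ lookup p i Bool.≤ lookup (flip p i) i
    down le rewrite lookup∘updateAt i {not} p | pi with () ← le

  module _ {A} (fine : ∀ p → Fine A p) where

    private
      descend : ∀ k p → weight p ≡ k → ∃ λ a → a ∈ A × AlmostDecPath h p a
      descend k p eq with fine p
      ... | inj₁ p∈ = p , p∈ , allDec done
      ... | inj₂ (inj₂ (v , v∈ , a)) = v , v∈ , oneArc done a done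
      descend zero p eq | inj₂ (inj₁ (i , pi , qi)) with () ← trans (sym eq) (weight-flip p i pi)
      descend (suc k) p eq | inj₂ (inj₁ dn@(i , pi , qi))
        with descend k (flip p i) (suc-injective (trans (sym (weight-flip p i pi)) eq))
      ... | a , a∈ , allDec path       = a , a∈ , allDec (step (Dn-arc dn) path)
      ... | a , a∈ , oneArc path b end = a , a∈ , oneArc (step (Dn-arc dn) path) b end

    -- Decreasing arcs lower the weight, so the descent ends. An arc of unknown direction is taken
    -- only once, as the last one, straight into `A`.
    almost-dec-paths : ∀ p → ∃ λ a → a ∈ A × AlmostDecPath h p a
    almost-dec-paths p = descend (weight p) p refl

  -- Neighbours in the list have arcs both ways. A closed set that meets the list therefore travels
  -- back to its head and from there over the whole list.
  chain-attractor : ∀ {a as} → Linked _⇄_ (a ∷ as) → Closed h (_∈ a ∷ as) →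
                    IsAttractor h (a ∷ as)
  chain-attractor {a} {as} link closed =
    (a , here refl) , closed ,
    λ Y (y , Yy) Y⊆ cl x x∈ → spread Y cl link (gather Y cl link (Y⊆ y Yy) Yy) x∈
    where
    module _ (Y : Config n → Set) (cl : Closed h Y) where
      gather : ∀ {a as y} → Linked _⇄_ (a ∷ as) → y ∈ a ∷ as → Y y → Y a
      gather _                  (here refl) Yy = Yy
      gather ((_ , back) ∷ lnk) (there y∈)  Yy = cl _ _ (gather lnk y∈ Yy) back
      spread : ∀ {a as x} → Linked _⇄_ (a ∷ as) → Y a → x ∈ a ∷ as → Y x
      spread _                 Ya (here refl) = Ya
      spread ((forw , _) ∷ lnk) Ya (there x∈) = spread lnk (cl _ _ Ya forw) x∈

Result : F n → Set₁
Result {n} h = Σ (List (Config n)) λ A → IsAttractor h A × (length A ≤ 4)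
               × (∀ x → ∃ λ a → (a ∈ A) × AlmostDecPath h x a)

-- The out-neighbours of the first vector when the second is its image: one flip for each bit where
-- they differ.
changes : Vec Bool m → Vec Bool m → List (Vec Bool m)
changes []       []       = []
changes (a ∷ as) (b ∷ bs) =
  (if a xor b then (not a ∷ as) ∷ [] else []) ++ map (a ∷_) (changes as bs)

flip-changes : (ps qs : Vec Bool m) (r : Vec Bool n) (i : Fin _) →
               lookup (qs ++ᵛ r) i ≢ lookup (ps ++ᵛ r) i →
               flip (ps ++ᵛ r) i ∈ map (_++ᵛ r) (changes ps qs)
flip-changes []           []           r i neq = contradiction refl neq
flip-changes (true ∷ ps)  (true ∷ qs)  r zero neq = contradiction refl neq
flip-changes (false ∷ ps) (false ∷ qs) r zero neq = contradiction refl neq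
flip-changes (true ∷ ps)  (false ∷ qs) r zero neq = here refl
flip-changes (false ∷ ps) (true ∷ qs)  r zero neq = here refl
flip-changes (p ∷ ps)     (q ∷ qs)     r (suc i) neq
  with d , d∈ , eq ← ∈-map⁻ (_++ᵛ r) (flip-changes ps qs r i neq) =
  subst (_∈ map (_++ᵛ r) (changes (p ∷ ps) (q ∷ qs))) (cong (p ∷_) (sym eq))
    (∈-map⁺ (_++ᵛ r) (∈-++⁺ʳ (if p xor q then (not p ∷ ps) ∷ [] else []) (∈-map⁺ (p ∷_) d∈)))

-- A configuration and its image that share the tail `r` have arcs in the prefix only. Closure thus
-- becomes a check on an explicit finite list, whatever the dimension.
arcs-within : {h : F (m + n)} {A : List (Config (m + n))} (ps qs : Vec Bool m) (r : Vec Bool n) →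
              h (ps ++ᵛ r) ≡ qs ++ᵛ r → All (_∈ A) (map (_++ᵛ r) (changes ps qs)) →
              ∀ {y} → Arc h (ps ++ᵛ r) y → y ∈ A
arcs-within ps qs r eq all (i , neq , refl) =
  All.lookup all (flip-changes ps qs r i (subst (λ q → lookup q i ≢ _) eq neq))

-- Conjugates of `f` from a table of positions and elements.

module _ (f : F n) (L : List (Config n × Config n))
         (pos↭ : map proj₁ L ↭ cube n) (elt↭ : map proj₂ L ↭ cube n) where

  private
    functional : ∀ {p e e′} → (p , e) ∈ L → (p , e′) ∈ L → e ≡ e′
    functional m m′ = cong proj₂
      (Unique-map⁻-injective proj₁ (Unique-resp-↭ (↭-sym pos↭) (cube-Unique n)) m m′ refl)

    injective : ∀ {p p′ e} → (p , e) ∈ L → (p′ , e) ∈ L → p ≡ p′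
    injective m m′ = cong proj₁
      (Unique-map⁻-injective proj₂ (Unique-resp-↭ (↭-sym elt↭) (cube-Unique n)) m m′ refl)

    element : ∀ p → ∃ λ e → (p , e) ∈ L
    element p with (_ , e) , m , refl ← ∈-map⁻ proj₁ (∈-resp-↭ (↭-sym pos↭) (cube-complete p)) = e , m

    position : ∀ e → ∃ λ p → (p , e) ∈ L
    position e with (p , _) , m , refl ← ∈-map⁻ proj₂ (∈-resp-↭ (↭-sym elt↭) (cube-complete e)) = p , m

    π : Config n ↔ Config n
    π = mk↔ₛ′ (λ p → proj₁ (element p)) (λ e → proj₁ (position e))
          (λ e → functional (proj₂ (element _)) (proj₂ (position e)))
          (λ p → injective (proj₂ (position _)) (proj₂ (element p)))

    h : F n
    h p = proj₁ (position (f (proj₁ (element p))))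

  -- Both columns of `L` enumerate the cube, so `L` is the graph of a bijection from positions to
  -- elements, and `h` is `f` carried over to positions.
  realise : (∀ h → (∀ {p e p′} → (p , e) ∈ L → (p′ , f e) ∈ L → h p ≡ p′) → Result h) →
            Σ (F n) λ h → (h ∼ f) × Result h
  realise res = h
    , (π , λ p → functional (proj₂ (element (h p))) (proj₂ (position _)))
    , res h λ {p} {e} {p′} m m′ →
        injective (proj₂ (position _))
          (subst (λ e → (p′ , f e) ∈ L) (functional m (proj₂ (element p))) m′)

-- Splitting the cube into blocks of positions.

AllPairs-++⁻ : ∀ {A : Set} {_~_ : A → A → Set} xs {ys} → AllPairs _~_ (xs ++ ys) →
               AllPairs _~_ xs × AllPairs _~_ ys × All (λ x → All (x ~_) ys) xs
AllPairs-++⁻ []       prs       = [] , prs , []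
AllPairs-++⁻ (x ∷ xs) (p ∷ prs) =
  let l , r , c = AllPairs-++⁻ xs prs in
  All.++⁻ˡ xs p ∷ l , r , All.++⁻ʳ xs p ∷ c

AllPairs-drop-middle : ∀ {A : Set} {_~_ : A → A → Set} xs ys {zs} →
                       AllPairs _~_ (xs ++ ys ++ zs) → AllPairs _~_ (xs ++ zs)
AllPairs-drop-middle xs ys prs =
  let l , r , c = AllPairs-++⁻ xs prs in
  AllPairs.++⁺ l (proj₁ (proj₂ (AllPairs-++⁻ ys r))) (All.map (All.++⁻ʳ ys) c)

complement : ∀ {A : Set} {S : List A} D → Unique D → (∀ {x} → x ∈ D → x ∈ S) →
             ∃ λ R → S ↭ D ++ R
complement {S = S} [] _ _ = S , ↭-refl
complement (d ∷ D) u sub =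
  let S′ , S↭ = extract (sub (here refl))
      R , S′↭ = complement D (Unique-∷⁻ u) λ x∈ →
                  tail-∈ (∈-resp-↭ S↭ (sub (there x∈))) λ { refl → Unique[x∷xs]⇒x∉xs u x∈ }
  in R , ↭-trans S↭ (prep d S′↭)

-- Descending order regrouped into pairs of an even position and the odd one after it, as
-- `solvable-pair` wants. The odd position over the first vector and the even one over the last are
-- left out.
zigzag : Config n → List (Config n) → List (Config (suc n))
zigzag v []       = []
zigzag v (w ∷ ws) = (false ∷ v) ∷ (true ∷ w) ∷ zigzag w ws

double-zigzag : (v : Config n) (ws : List (Config n)) (z : Config n) →
                double (v ∷ ws ++ z ∷ []) ≡ (true ∷ v) ∷ zigzag v (ws ++ z ∷ []) ++ (false ∷ z) ∷ []
double-zigzag v []       z = refl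
double-zigzag v (w ∷ ws) z = cong (λ l → (true ∷ v) ∷ (false ∷ v) ∷ l) (double-zigzag w ws z)

zeros ones : ∀ n → Config n
zeros n = replicate n false
ones n = replicate n true

cube-ends : ∀ k → ∃ λ mid → cube (suc k) ≡ ones (suc k) ∷ mid ++ zeros (suc k) ∷ []
cube-ends zero    = [] , refl
cube-ends (suc k) with mid , eq ← cube-ends k =
  (false ∷ ones (suc k)) ∷ double mid ++ (true ∷ zeros (suc k)) ∷ [] ,
  trans (cong double eq) (cong (λ l → _ ∷ _ ∷ l)
    (trans (double-++ mid _) (sym (++-assoc (double mid) _ _))))

octant : Config n → List (Config (3 + n))
octant r = (true ∷ true ∷ true ∷ r) ∷ (false ∷ true ∷ true ∷ r) ∷ (true ∷ false ∷ true ∷ r)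
         ∷ (false ∷ false ∷ true ∷ r) ∷ (true ∷ true ∷ false ∷ r) ∷ (false ∷ true ∷ false ∷ r)
         ∷ (true ∷ false ∷ false ∷ r) ∷ (false ∷ false ∷ false ∷ r) ∷ []

-- The middle part is shown to be non-empty because `two-long-paths` fills the first pair below the
-- top by hand.
cube-octant : ∀ k → ∃ λ v → ∃ λ vs →
              cube (4 + k) ≡ ones (4 + k) ∷ (v ∷ vs) ++ octant (zeros (suc k))
cube-octant k with mid , eq ← cube-ends k =
  _ , double ((false ∷ true ∷ ones (suc k)) ∷ double ((false ∷ ones (suc k)) ∷ double mid)) ,
  trans (cong (λ l → double (double (double l))) eq)
 (trans (cong (λ l → double (double l)) (double-++ top bottom))
 (trans (cong double (double-++ (double top) (double bottom)))
        (double-++ (double (double top)) (double (double bottom)))))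
  where
  top    = ones (suc k) ∷ mid
  bottom = zeros (suc k) ∷ []

-- From a placement to a conjugate network.

module Layout {n} (f : F (suc n)) (f-nofix : ∀ x → f x ≢ x) where

  _≟ᶜ_ : DecidableEquality (Config (suc n))
  _≟ᶜ_ = ≡-dec Bool._≟_

  open Place _≟ᶜ_ f f-nofix 
    (λ (p : Config (suc n)) → lookup p zero ≡ false) (λ p → lookup p zero ≡ true) public

  solvable-zigzag : ∀ {ps} → Solvable ps → ∀ v ws → Solvable (zigzag v ws ++ ps)
  solvable-zigzag solve v []       = solve
  solvable-zigzag solve v (w ∷ ws) = solvable-pair refl refl (solvable-zigzag solve w ws)

  solvable-zigzag₀ : ∀ v ws → Solvable (zigzag v ws)
  solvable-zigzag₀ v ws = subst Solvable (++-identityʳ _) (solvable-zigzag solvable-[] v ws)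

  -- If the image is listed later, the descending order supplies the bit; if it is listed earlier,
  -- `Good` supplies bit 0.
  good⇒Dn : ∀ {M} → AllPairs Dn (map proj₁ M) → AllPairs Good M →
            ∀ {p e p′} → (p , e) ∈ M → (p′ , f e) ∈ M → Dn p p′
  good⇒Dn dn good m m′ with ∈-AllPairs₂ (AllPairs.zip (AllPairs.map⁻ dn , good)) m m′
  ... | inj₁ eq                = contradiction (sym (cong proj₂ eq)) (f-nofix _)
  ... | inj₂ (inj₁ (d , _))    = d
  ... | inj₂ (inj₂ (_ , fwd)) with even , odd ← fwd refl = zero , odd , even

  locate : ∀ {T t ps R o e} (π : Placement ps R o) → e ∈ t ∷ R →
           ∃ λ p → (p , e) ∈ (T , t) ∷ Placement.pairs π
  locate π (here refl) = _ , here refl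
  locate π (there e∈)  = let p , m = Placement.position-of π e∈ in p , there m

  -- `M` is the part filled by a placement together with the top, `low` the part laid out by hand.
  -- Images within `M` are left out, being settled by `good⇒Dn`. The equation `f e ≡ e′` allows
  -- cycles to close up propositionally.
  record Respects (h : F (suc n)) (T t : Config (suc n)) ps R (M low : List (Config (suc n) × Config (suc n))) : Set where
    field
      position-∈ : ∀ {p e} → (p , e) ∈ M → p ∈ T ∷ ps
      element-∈  : ∀ {p e} → (p , e) ∈ M → e ∈ t ∷ R
      low-low    : ∀ {p e p′ e′} → (p , e) ∈ low → f e ≡ e′ → (p′ , e′) ∈ low → h p ≡ p′
      low-M      : ∀ {p e p′ e′} → (p , e) ∈ low → f e ≡ e′ → (p′ , e′) ∈ M → h p ≡ p′
      M-low      : ∀ {p e p′ e′} → (p , e) ∈ M → f e ≡ e′ → (p′ , e′) ∈ low → h p ≡ p′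

  -- No element of `R` maps to `t`, so adding it at `T` keeps all pairs good and images within `M`
  -- are harmless. What `build` still owes is the attractor, the reserved positions and the images
  -- from `M` into them.
  assemble : ∀ {T ps t R o} (π : Placement ps R o) (low : List (Config (suc n) × Config (suc n))) →
    AllPairs Dn (T ∷ ps) → Leaf R t →
    (T ∷ ps) ++ map proj₁ low ↭ cube (suc n) → (t ∷ R) ++ map proj₂ low ↭ cube (suc n) →
    (∀ h → let open Attract h ; M = (T , t) ∷ Placement.pairs π in
       Respects h T t ps R M low →
       ∃ λ a → ∃ λ as → Linked _⇄_ (a ∷ as) × Closed h (_∈ a ∷ as) × length (a ∷ as) ≤ 4 ×
         All (λ (s , _) → Fine (a ∷ as) s) low ×
         (∀ {p e s} → (p , e) ∈ M → (s , f e) ∈ low → Fine (a ∷ as) p)) →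
    Σ (F (suc n)) λ h → (h ∼ f) × Result h
  assemble {T} {ps} {t} {R} π low dn leaf pos↭ elt↭ build = realise f L pos↭′ elt↭′ λ h resp →
    let a , as , link , closed , len , low-fine , hit = build h record
          { position-∈ = λ {p} m → subst (p ∈_) M-pos (∈-map⁺ proj₁ m)
          ; element-∈  = λ m → ∈-resp-↭ (prep t elements) (∈-map⁺ proj₂ m)
          ; low-low    = λ { m refl m′ → resp (∈-++⁺ʳ M m) (∈-++⁺ʳ M m′) }
          ; low-M      = λ { m refl m′ → resp (∈-++⁺ʳ M m) (∈-++⁺ˡ m′) }
          ; M-low      = λ { m refl m′ → resp (∈-++⁺ˡ m) (∈-++⁺ʳ M m′) } }
        open Attract h
        M-fine : ∀ {p e p′} → (p , e) ∈ M → (p′ , f e) ∈ L → Fine (a ∷ as) p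
        M-fine {p} m m′ = case ∈-++⁻ M m′ of λ where
          (inj₁ m″) → inj₂ (inj₁ (subst (Dn p) (sym (resp (∈-++⁺ˡ m) m′)) (good⇒Dn dn′ good′ m m″)))
          (inj₂ m″) → hit m m″
        fine : ∀ p → Fine (a ∷ as) p
        fine p = case ∈-map⁻ proj₁ (∈-resp-↭ (↭-sym pos↭′) (cube-complete p)) of λ where
          ((_ , e) , m , refl) → case ∈-++⁻ M m of λ where
            (inj₂ m₂) → All.lookup low-fine m₂
            (inj₁ m₁) → case ∈-map⁻ proj₂ (∈-resp-↭ (↭-sym elt↭′) (cube-complete (f e))) of λ where
              ((p′ , _) , m′ , refl) → M-fine m₁ m′
    in a ∷ as , chain-attractor link closed , len , almost-dec-paths fine
    where
    open Placement π using (pairs; positions; elements; good)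
    M = (T , t) ∷ pairs
    L = M ++ low
    M-pos : map proj₁ M ≡ T ∷ _
    M-pos = cong (T ∷_) positions
    dn′ : AllPairs Dn (map proj₁ M)
    dn′ = subst (AllPairs Dn) (sym M-pos) dn
    good′ : AllPairs Good M
    good′ = All.tabulate (λ m eq → contradiction eq (leaf (Placement.element-∈ π m))) ∷ good
    pos↭′ : map proj₁ L ↭ cube (suc n)
    pos↭′ = ↭-trans (↭-reflexive (trans (map-++ proj₁ M low) (cong (_++ map proj₁ low) M-pos))) pos↭
    elt↭′ : map proj₂ L ↭ cube (suc n)
    elt↭′ = ↭-trans (↭-reflexive (map-++ proj₂ M low))
                    (↭-trans (++⁺ʳ (map proj₂ low) (prep t elements)) elt↭)

  upper-length : ∀ {T t : Config (suc n)} ps R {low low′} →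
                (T ∷ ps) ++ low ↭ cube (suc n) → (t ∷ R) ++ low′ ↭ cube (suc n) →
                length low′ ≡ length low → length R ≡ length ps
  upper-length {T} {t} ps R {low} {low′} p q eq = suc-injective (+-cancelʳ-≡ (length low) _ _ (trans
    (cong (suc (length R) +_) (sym eq)) (trans (sym (length-++ (t ∷ R))) (trans
    (trans (↭-length q) (sym (↭-length p))) (length-++ (T ∷ ps))))))

-- The reserved positions are the even ones over Bs, 0 among them; moving them below
-- their odd neighbours keeps the order a linear extension.
module Bottom {n} {top v : Config n} (X Bs : List (Config n)) (eq : cube n ≡ (top ∷ X) ++ v ∷ Bs) where

  upper reserved : List (Config (suc n))
  upper    = zigzag top (X ++ v ∷ []) ++ (false ∷ v) ∷ map (true ∷_) Bs
  reserved = map (false ∷_) Bs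

  private
    eq′ : cube n ≡ (top ∷ X ++ v ∷ []) ++ Bs
    eq′ = trans eq (cong (top ∷_) (sym (++-assoc X (v ∷ []) Bs)))

    layout : ((true ∷ top) ∷ upper) ++ reserved ≡
             double (top ∷ X ++ v ∷ []) ++ map (true ∷_) Bs ++ reserved
    layout = sym (trans (cong (_++ map (true ∷_) Bs ++ reserved) (double-zigzag top X v))
      (cong ((true ∷ top) ∷_) (trans (++-assoc (zigzag top (X ++ v ∷ [])) _ _)
        (sym (++-assoc (zigzag top (X ++ v ∷ [])) _ reserved)))))

    double-↭ : (vs : List (Config n)) → map (true ∷_) vs ++ map (false ∷_) vs ↭ double vs
    double-↭ []       = ↭-refl
    double-↭ (w ∷ ws) = prep _ (↭-trans (shift _ (map (true ∷_) ws) _) (prep _ (double-↭ ws)))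

  positions-↭ : ((true ∷ top) ∷ upper) ++ reserved ↭ cube (suc n)
  positions-↭ = ↭-trans (↭-reflexive layout) (↭-trans (++⁺ˡ (double (top ∷ X ++ v ∷ [])) (double-↭ Bs))
    (↭-reflexive (sym (trans (cong double eq′) (double-++ (top ∷ X ++ v ∷ []) Bs)))))

  positions-Dn : AllPairs Dn (((true ∷ top) ∷ upper) ++ reserved)
  positions-Dn = subst (AllPairs Dn) (sym layout) (AllPairs.++⁺ (double-Dn dnX)
    (AllPairs.++⁺ (AllPairs.map⁺ (AllPairs.map Dn-∷ dnB)) (AllPairs.map⁺ (AllPairs.map Dn-∷ dnB))
      (All.map⁺ (All.tabulate λ _ → All.map⁺ (All.tabulate λ _ → zero , refl , refl))))
    (double-All (λ b dns → All.++⁺ (All.map⁺ (All.map Dn-∷ dns)) (All.map⁺ (All.map Dn-∷ dns))) cross))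
    where
    parts = AllPairs-++⁻ (top ∷ X ++ v ∷ []) (subst (AllPairs Dn) eq′ (cube-Dn n))
    dnX   = proj₁ parts
    dnB   = proj₁ (proj₂ parts)
    cross = proj₂ (proj₂ parts)
    double-All : ∀ {P : Config n → Set} {Q : Config (suc n) → Set} {vs} →
                 (∀ b {v} → P v → Q (b ∷ v)) → All P vs → All Q (double vs)
    double-All q []       = []
    double-All q (p ∷ ps) = q true p ∷ q false p ∷ double-All q ps

-- Here whole pairs of positions are reserved, and so is 0, whose image must be arranged
-- so that 0 has an arc into the attractor.
module Middle {n} {top z : Config n} (X Bs Y : List (Config n))
              (eq : cube n ≡ (top ∷ X) ++ Bs ++ (Y ++ z ∷ [])) where

  upper reserved : List (Config (suc n))
  upper    = zigzag top ((X ++ Y) ++ z ∷ [])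
  reserved = (false ∷ z) ∷ double Bs

  private
    layout : ((true ∷ top) ∷ upper) ++ (false ∷ z) ∷ [] ≡ double ((top ∷ X) ++ (Y ++ z ∷ []))
    layout = sym (trans (cong (λ l → double (top ∷ l)) (sym (++-assoc X Y (z ∷ []))))
                        (double-zigzag top (X ++ Y) z))

  positions-↭ : ((true ∷ top) ∷ upper) ++ reserved ↭ cube (suc n)
  positions-↭ = ↭-trans (↭-reflexive (trans (sym (++-assoc ((true ∷ top) ∷ upper) ((false ∷ z) ∷ []) (double Bs)))
       (trans (cong (_++ double Bs) layout)
         (sym (double-++ ((top ∷ X) ++ (Y ++ z ∷ [])) Bs)))))
    (↭-trans (double-resp-↭ tails-↭) (↭-reflexive (cong double (sym eq))))
    where
    double-resp-↭ : ∀ {vs ws : List (Config n)} → vs ↭ ws → double vs ↭ double ws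
    double-resp-↭ _↭_.refl         = ↭-refl
    double-resp-↭ (prep x p)   = prep _ (prep _ (double-resp-↭ p))
    double-resp-↭ (swap x y p) = ↭-trans
      (shifts (_ ∷ _ ∷ []) (_ ∷ _ ∷ [])) (prep _ (prep _ (prep _ (prep _ (double-resp-↭ p)))))
    double-resp-↭ (_↭_.trans p q)  = ↭-trans (double-resp-↭ p) (double-resp-↭ q)
    tails-↭ : ((top ∷ X) ++ (Y ++ z ∷ [])) ++ Bs ↭ (top ∷ X) ++ Bs ++ (Y ++ z ∷ [])
    tails-↭ = ↭-trans (↭-reflexive (++-assoc (top ∷ X) (Y ++ z ∷ []) Bs))
                      (++⁺ˡ (top ∷ X) (++-comm (Y ++ z ∷ []) Bs))

  positions-Dn : AllPairs Dn (((true ∷ top) ∷ upper) ++ (false ∷ z) ∷ [])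
  positions-Dn = subst (AllPairs Dn) (sym layout)
    (double-Dn (AllPairs-drop-middle (top ∷ X) Bs (subst (AllPairs Dn) eq (cube-Dn n))))

-- Attractors on a square.

pattern O = false
pattern I = true

-- Selects the corner for an element with image at `q`: the one with only bit `i` set, unless `q`
-- agrees with it on both bits; then the one with only bit `j` set.
orientation : ∀ {n} → Fin n → Fin n → Config n → Bool
orientation i j q = not (lookup q i ∧ not (lookup q j))

module Square {n} (e : Bool → Bool → Config n) (i j : Fin n)
  (e-i : ∀ a b → lookup (e a b) i ≡ a) (e-j : ∀ a b → lookup (e a b) j ≡ b)
  (flip-i : ∀ a b → flip (e a b) i ≡ e (not a) b) (flip-j : ∀ a b → flip (e a b) j ≡ e a (not b))
  (e-const : ∀ l a b a′ b′ → l ≡ i ⊎ l ≡ j ⊎ lookup (e a b) l ≡ lookup (e a′ b′) l)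
  (h : F n) where

  open Attract h

  private
    arc-i : ∀ {a b q} → h (e a b) ≡ q → lookup q i ≢ a → Arc h (e a b) (e (not a) b)
    arc-i {a} {b} eq neq = subst (Arc h _) (flip-i a b) (arc eq i (subst (_ ≢_) (sym (e-i a b)) neq))

    arc-j : ∀ {a b q} → h (e a b) ≡ q → lookup q j ≢ b → Arc h (e a b) (e a (not b))
    arc-j {a} {b} eq neq = subst (Arc h _) (flip-j a b) (arc eq j (subst (_ ≢_) (sym (e-j a b)) neq))

    arc-ii : ∀ {a b a′ b′} → h (e a b) ≡ e a′ b′ → a′ ≢ a → Arc h (e a b) (e (not a) b)
    arc-ii eq neq = arc-i eq (subst (_≢ _) (sym (e-i _ _)) neq)

    arc-jj : ∀ {a b a′ b′} → h (e a b) ≡ e a′ b′ → b′ ≢ b → Arc h (e a b) (e a (not b))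
    arc-jj eq neq = arc-j eq (subst (_≢ _) (sym (e-j _ _)) neq)

    arcs-from : ∀ {a b a′ b′ y} → h (e a b) ≡ e a′ b′ → Arc h (e a b) y →
                (a′ ≢ a × y ≡ e (not a) b) ⊎ (b′ ≢ b × y ≡ e a (not b))
    arcs-from {a} {b} {a′} {b′} eq (l , neq , refl) with subst (λ q → lookup q l ≢ _) eq neq
    ... | neq′ with e-const l a′ b′ a b
    ...   | inj₁ refl        = inj₁ ((λ { refl → neq′ (trans (e-i _ b′) (sym (e-i a b))) }) , flip-i a b)
    ...   | inj₂ (inj₁ refl) = inj₂ ((λ { refl → neq′ (trans (e-j a′ _) (sym (e-j a b))) }) , flip-j a b)
    ...   | inj₂ (inj₂ same) = contradiction same neq′

  -- The orientation o decides which of the two middle corners is c and which is z = f c.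
  fork-linked : ∀ o → h (e O O) ≡ e (not o) o → h (e I I) ≡ e (not o) o → h (e (not o) o) ≡ e o (not o) →
                Linked _⇄_ (e O O ∷ e (not o) o ∷ e I I ∷ [])
  fork-linked true  hx hy hc = (arc-jj hx (λ ()) , arc-jj hc (λ ())) ∷ (arc-ii hc (λ ()) , arc-ii hy (λ ())) ∷ [-]
  fork-linked false hx hy hc = (arc-ii hx (λ ()) , arc-ii hc (λ ())) ∷ (arc-jj hc (λ ()) , arc-jj hy (λ ())) ∷ [-]

  -- Each of `e O O` and `e I I` differs from its image in one bit, whose flip leads to that image.
  -- The corner of `c` maps to the opposite one, so its arcs lead to `e O O` and `e I I`, and the
  -- corner of `z` is never entered.
  fork-closed : ∀ o → h (e O O) ≡ e (not o) o → h (e I I) ≡ e (not o) o → h (e (not o) o) ≡ e o (not o) →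
                Closed h (_∈ e O O ∷ e (not o) o ∷ e I I ∷ [])
  fork-closed true  hx hy hc _ _ (here refl) a with arcs-from hx a
  ... | inj₁ (neq , _)  = contradiction refl neq
  ... | inj₂ (_ , refl) = there (here refl)
  fork-closed false hx hy hc _ _ (here refl) a with arcs-from hx a
  ... | inj₁ (_ , refl) = there (here refl)
  ... | inj₂ (neq , _)  = contradiction refl neq
  fork-closed true  hx hy hc _ _ (there (here refl)) a with arcs-from hc a
  ... | inj₁ (_ , refl) = there (there (here refl))
  ... | inj₂ (_ , refl) = here refl
  fork-closed false hx hy hc _ _ (there (here refl)) a with arcs-from hc a
  ... | inj₁ (_ , refl) = here refl
  ... | inj₂ (_ , refl) = there (there (here refl))
  fork-closed true  hx hy hc _ _ (there (there (here refl))) a with arcs-from hy a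
  ... | inj₁ (_ , refl) = there (here refl)
  ... | inj₂ (neq , _)  = contradiction refl neq
  fork-closed false hx hy hc _ _ (there (there (here refl))) a with arcs-from hy a
  ... | inj₁ (neq , _)  = contradiction refl neq
  ... | inj₂ (_ , refl) = there (here refl)

  module _ (hx : h (e O O) ≡ e I I) (hc : h (e I I) ≡ e I O)
           (hz : h (e I O) ≡ e O I) (hq : h (e O I) ≡ e O O) where

    -- The images of `e O O` and `e I O` are opposite corners, the other two adjacent ones. This way
    -- of laying the cycle on the square gives arcs both ways along three sides, listed in that
    -- order.
    four-cycle : List (Config n)
    four-cycle = e I I ∷ e I O ∷ e O O ∷ e O I ∷ []

    four-cycle-linked : Linked _⇄_ four-cycle
    four-cycle-linked = (arc-jj hc (λ ()) , arc-jj hz (λ ())) ∷ (arc-ii hz (λ ()) , arc-ii hx (λ ()))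
                      ∷ (arc-jj hx (λ ()) , arc-jj hq (λ ())) ∷ [-]

    private
      corner : ∀ a b → e a b ∈ four-cycle
      corner I I = here refl
      corner I O = there (here refl)
      corner O O = there (there (here refl))
      corner O I = there (there (there (here refl)))

      from-corner : ∀ {a b a′ b′ y} → h (e a b) ≡ e a′ b′ → Arc h (e a b) y → y ∈ four-cycle
      from-corner eq a with arcs-from eq a
      ... | inj₁ (_ , refl) = corner _ _
      ... | inj₂ (_ , refl) = corner _ _

    four-cycle-closed : Closed h (_∈ four-cycle)
    four-cycle-closed _ _ (here refl)                         = from-corner hc
    four-cycle-closed _ _ (there (here refl))                 = from-corner hz
    four-cycle-closed _ _ (there (there (here refl)))         = from-corner hx
    four-cycle-closed _ _ (there (there (there (here refl)))) = from-corner hq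

  -- If z maps above itself, this orientation makes it map above e I I as well.
  fork-fine : ∀ q → let o = orientation i j q in h (e o (not o)) ≡ q →
              Fine (e O O ∷ e (not o) o ∷ e I I ∷ []) (e o (not o))
  fork-fine q hz with lookup q i in qi | lookup q j in qj
  ... | false | _     = inj₂ (inj₁ (i , e-i I O , trans (cong (λ p → lookup p i) hz) qi))
  ... | true  | false = inj₂ (inj₁ (j , e-j O I , trans (cong (λ p → lookup p j) hz) qj))
  ... | true  | true  = inj₂ (inj₂ (e I I , there (there (here refl)) , arc-j hz (subst (_≢ O) (sym qj) λ ())))

-- Coordinates for the positions near 0.

module Network (k : ℕ) (f : F (5 + k)) (f-nofix : ∀ x → f x ≢ x) where

  open Layout f f-nofix

  Goal : Set₁
  Goal = Σ (F (5 + k)) λ h → (h ∼ f) × Result h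

  r : Config (suc k)
  r = zeros (suc k)

  at : Bool → Bool → Bool → Bool → Config (5 + k)
  at a b c d = a ∷ b ∷ c ∷ d ∷ r

  -- The bottom square has 0 as a corner and consists of even positions, as `Bottom` reserves them.
  -- The middle square varies bit 0, so it fills two whole pairs, as `Middle` reserves them.
  at-bottom at-middle : Bool → Bool → Config (5 + k)
  at-bottom a b = at O a b O
  at-middle a b = at a b O I

  bottom-const : ∀ l a b a′ b′ →
    l ≡ suc zero ⊎ l ≡ suc (suc zero) ⊎ lookup (at-bottom a b) l ≡ lookup (at-bottom a′ b′) l
  bottom-const zero                _ _ _ _ = inj₂ (inj₂ refl)
  bottom-const (suc zero)          _ _ _ _ = inj₁ refl
  bottom-const (suc (suc zero))    _ _ _ _ = inj₂ (inj₁ refl)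
  bottom-const (suc (suc (suc _))) _ _ _ _ = inj₂ (inj₂ refl)

  middle-const : ∀ l a b a′ b′ →
    l ≡ zero ⊎ l ≡ suc zero ⊎ lookup (at-middle a b) l ≡ lookup (at-middle a′ b′) l
  middle-const zero          _ _ _ _ = inj₁ refl
  middle-const (suc zero)    _ _ _ _ = inj₂ (inj₁ refl)
  middle-const (suc (suc _)) _ _ _ _ = inj₂ (inj₂ refl)

  V : List (Config (5 + k))
  V = cube (5 + k)

  private
    abstract
      v₀ : Config (4 + k)
      v₀ = proj₁ (cube-octant k)

      vs₀ : List (Config (4 + k))
      vs₀ = proj₁ (proj₂ (cube-octant k))

      cube-split : cube (4 + k) ≡ ones (4 + k) ∷ (v₀ ∷ vs₀) ++ octant r
      cube-split = proj₂ (proj₂ (cube-octant k))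

    front : List (Config (4 + k))
    front = v₀ ∷ vs₀

    split : ∀ j → cube (4 + k) ≡ (ones (4 + k) ∷ front ++ take j (octant r)) ++ drop j (octant r)
    split j = trans cube-split (cong (ones (4 + k) ∷_)
      (trans (cong (front ++_) (sym (take++drop≡id j (octant r)))) (sym (++-assoc front _ _))))

  Unique-tail : ∀ {D R} → V ↭ D ++ R → Unique R
  Unique-tail {D} p = proj₁ (proj₂ (AllPairs-++⁻ D (Unique-resp-↭ p (cube-Unique (5 + k)))))

  disjoint : ∀ {D R} → V ↭ D ++ R → ∀ {e} → e ∈ R → e ∉ D
  disjoint {D} p e∈R e∈D =
    All.lookup (All.lookup (proj₂ (proj₂ (AllPairs-++⁻ D (Unique-resp-↭ p (cube-Unique (5 + k)))))) e∈D)
      e∈R refl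

  -- A 2-cycle, and layouts for a remainder permuted by `f`.

  module _ {a R ℓ} (ffa : f (f a) ≡ a) (V↭ : V ↭ (f a ∷ a ∷ []) ++ R)
           (ℓ∈ : ℓ ∈ R) (leaf : Leaf R ℓ) where

    private
      open Bottom (front ++ take 5 (octant r)) (drop 6 (octant r)) (split 5)

      R₁ = proj₁ (extract ℓ∈)
      R↭ : R ↭ ℓ ∷ R₁
      R↭ = proj₂ (extract ℓ∈)

      low : List (Config (5 + k) × Config (5 + k))
      low = (at O I O O , f a) ∷ (at O O O O , a) ∷ []

      elements-↭ : (ℓ ∷ R₁) ++ map proj₂ low ↭ V
      elements-↭ = ↭-sym (↭-trans V↭ (↭-trans (++⁺ˡ (f a ∷ a ∷ []) R↭) (++-comm _ (ℓ ∷ R₁))))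

      u : Unique (ℓ ∷ R₁)
      u = Unique-resp-↭ R↭ (Unique-tail {f a ∷ a ∷ []} V↭)

      π : Placement upper R₁ ℓ
      -- Two even positions are reserved at the bottom, so below the zigzag remain one pair and a
      -- single odd position.
      π = solvable-zigzag (solvable-pair {e = at O O I O} {d = at I I O O} refl refl
            (solvable-[_] {d = at I O O O} refl)) (ones (4 + k)) ((front ++ take 5 (octant r)) ++ _) R₁ ℓ
            (Unique-∷⁻ u) (upper-length upper R₁ positions-↭ elements-↭ refl)
            (λ ℓ∈₁ → contradiction ℓ∈₁ (Unique[x∷xs]⇒x∉xs u))

    -- The leaf takes the top. The 2-cycle takes 0 and its neighbour `at O I O O`, which come last
    -- in the order, so images there are harmless.
    two-cycle-leaf : Goal
    two-cycle-leaf = assemble π low (proj₁ (AllPairs-++⁻ (_ ∷ upper) positions-Dn))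
      (λ e∈ → leaf (∈-resp-↭ (↭-sym R↭) (there e∈))) positions-↭ elements-↭ λ h resp →
      let open Attract h
          open Respects resp
          ha : h (at O O O O) ≡ at O I O O
          ha  = low-low (there (here refl)) refl (here refl)
          hfa : h (at O I O O) ≡ at O O O O
          hfa = low-low (here refl) ffa (there (here refl))
      in at O O O O , at O I O O ∷ []
         , (arc ha (suc zero) (λ ()) , arc hfa (suc zero) (λ ())) ∷ [-]
         , (λ { _ _ (here refl)         → arcs-within {h = h} (O ∷ O ∷ O ∷ O ∷ []) (O ∷ I ∷ O ∷ O ∷ []) r ha (there (here refl) ∷ [])
              ; _ _ (there (here refl)) → arcs-within {h = h} (O ∷ I ∷ O ∷ O ∷ []) (O ∷ O ∷ O ∷ O ∷ []) r hfa (here refl ∷ []) })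
         , s≤s (s≤s z≤n)
         , inj₁ (there (here refl)) ∷ inj₁ (here refl) ∷ []
         , λ {p} m m′ → inj₂ (inj₁ (subst (Dn p) (sym (M-low m refl m′))
             (All.lookup (All.lookup (proj₂ (proj₂ (AllPairs-++⁻ (_ ∷ upper) positions-Dn)))
               (position-∈ m)) (∈-map⁺ proj₁ m′))))

  -- As `f` permutes `R`, nothing placed maps into `B`, whose block of positions therefore need not
  -- come last. The top gets some `t` in `R`, and its only preimage in `R`, `u`, gets 0. So 0 maps
  -- to all ones and reaches `at O O O I` by flipping bit 3, which is why the attractor must contain
  -- that position.
  module ClosedLayout X Bs Y (eq : cube (4 + k) ≡ (ones (4 + k) ∷ X) ++ Bs ++ (Y ++ zeros (4 + k) ∷ []))
    B {R t} (V↭ : V ↭ B ++ R) (len : length B ≡ length (double Bs)) (cov : Covers R R) (t∈ : t ∈ R) where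

    open Middle X Bs Y eq

    private
      uR : Unique R
      uR = Unique-tail {B} V↭

    module Placed {u R₂} (fu : f u ≡ t) (R↭ : R ↭ t ∷ u ∷ R₂) (π : Placement upper R₂ t) where

      private
        uR₂ : Unique (t ∷ u ∷ R₂)
        uR₂ = Unique-resp-↭ R↭ uR

        u∈ : u ∈ R
        u∈ = ∈-resp-↭ (↭-sym R↭) (there (here refl))

      elements-↭ : (t ∷ R₂) ++ (u ∷ B) ↭ V
      elements-↭ = ↭-sym (↭-trans V↭ (↭-trans (++-comm B R) (↭-trans (++⁺ʳ B R↭)
        (prep t (↭-sym (shift u R₂ B))))))

      leaf : Leaf R₂ t
      leaf e∈ fe with refl ← covers⇒injective uR cov (∈-resp-↭ (↭-sym R↭) (there (there e∈))) u∈ (trans fe (sym fu)) =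
        Unique[x∷xs]⇒x∉xs (Unique-∷⁻ uR₂) e∈

      M : List (Config (5 + k) × Config (5 + k))
      M = (ones (5 + k) , t) ∷ Placement.pairs π

      position-of : ∀ {e} → e ∈ R → e ≡ u ⊎ ∃ λ p → (p , e) ∈ M
      position-of e∈ = case ∈-resp-↭ R↭ e∈ of λ where
        (here e≡t)         → inj₂ (locate π (here e≡t))
        (there (here e≡u)) → inj₁ e≡u
        (there (there e∈)) → inj₂ (locate π (there e∈))

      assemble-closed : ∀ low → map proj₁ low ≡ double Bs → map proj₂ low ↭ B →
        (∀ h → let open Attract h in
           Respects h (ones (5 + k)) t upper R₂ M ((at O O O O , u) ∷ low) →
           ∃ λ a → ∃ λ as → Linked _⇄_ (a ∷ as) × Closed h (_∈ a ∷ as) × length (a ∷ as) ≤ 4 ×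
             All (λ (s , _) → Fine (a ∷ as) s) low × at O O O I ∈ a ∷ as) → Goal
      assemble-closed low pos elt build = assemble π ((at O O O O , u) ∷ low)
        (proj₁ (AllPairs-++⁻ (_ ∷ upper) positions-Dn)) leaf
        (subst (λ l → (_ ∷ upper) ++ (_ ∷ l) ↭ V) (sym pos) positions-↭)
        (↭-trans (++⁺ˡ (t ∷ R₂) (prep u elt)) elements-↭)
        λ h resp →
        let open Attract h
            open Respects resp
            a , as , link , closed , short , fine , c∈ = build h resp
            h0 : h (at O O O O) ≡ ones (5 + k)
            h0 = low-M (here refl) fu (here refl)
            -- 0 comes last in the order, so an image there gives a decreasing arc; images in `B` do
            -- not occur.
            hit : ∀ {p e s} → (p , e) ∈ M → (s , f e) ∈ (at O O O O , u) ∷ low → Fine (a ∷ as) p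
            hit {p} m m′ = case m′ of λ where
              (here eq) → inj₂ (inj₁ (subst (Dn p) (sym (M-low m (cong proj₂ eq) (here refl)))
                 (All.lookup (All.lookup (proj₂ (proj₂ (AllPairs-++⁻ (_ ∷ upper) positions-Dn)))
                 (position-∈ m)) (here refl))))
              (there m″) → contradiction (∈-resp-↭ elt (∈-map⁺ proj₂ m″))
                 (disjoint {B} V↭ (covers⇒closed uR cov (t∷R₂⊆R (element-∈ m))))
        in a , as , link , closed , short
           , inj₂ (inj₂ (_ , c∈ , arc h0 (suc (suc (suc zero))) (λ ()))) ∷ fine
           , hit
        where
        t∷R₂⊆R : ∀ {e} → e ∈ t ∷ R₂ → e ∈ R
        t∷R₂⊆R (here refl) = t∈
        t∷R₂⊆R (there e∈)  = ∈-resp-↭ (↭-sym R↭) (there (there e∈))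

    place-rest : (∀ {u R₂} → f u ≡ t → R ↭ t ∷ u ∷ R₂ → Placement upper R₂ t → Goal) → Goal
    place-rest goal =
      let u , u∈ , fu = cov t∈
          R₁ , R↭₁ = extract t∈
          R₂ , R₁↭ = extract (tail-∈ (∈-resp-↭ R↭₁ u∈) λ u≡t → f-nofix u (trans fu (sym u≡t)))
          R↭  = ↭-trans R↭₁ (prep t R₁↭)
          uR₂ = Unique-resp-↭ R↭ uR
          elements-↭ = ↭-sym (↭-trans V↭ (↭-trans (++-comm B R) (↭-trans (++⁺ʳ B R↭)
                         (prep t (↭-sym (shift u R₂ B))))))
      in goal fu R↭ (solvable-zigzag₀ (ones (4 + k)) ((X ++ Y) ++ zeros (4 + k) ∷ []) R₂ t
           (Unique-∷⁻ (Unique-∷⁻ uR₂))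
           (upper-length upper R₂ {low = reserved} {low′ = u ∷ B} positions-↭ elements-↭ (cong suc len))
           (λ t∈₂ → contradiction (there t∈₂) (Unique[x∷xs]⇒x∉xs uR₂)))

  -- The 2-cycle takes one whole pair, differing in bit 0, whose even member is the target needed
  -- for the arc from 0.
  two-cycle-closed : ∀ {a R t} → f (f a) ≡ a → V ↭ (f a ∷ a ∷ []) ++ R → Covers R R → t ∈ R → Goal
  two-cycle-closed {a} ffa V↭ cov t∈ = place-rest λ fu R↭ π →
    Placed.assemble-closed fu R↭ π low refl ↭-refl λ h resp →
    let open Attract h
        open Respects resp
        ha : h (at O O O I) ≡ at I O O I
        ha  = low-low (there (there (here refl))) refl (there (here refl))
        hfa : h (at I O O I) ≡ at O O O I
        hfa = low-low (there (here refl)) ffa (there (there (here refl)))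
    in at O O O I , at I O O I ∷ []
       , (arc ha zero (λ ()) , arc hfa zero (λ ())) ∷ [-]
       , (λ { _ _ (here refl)         → arcs-within {h = h} (O ∷ O ∷ O ∷ I ∷ []) (I ∷ O ∷ O ∷ I ∷ []) r ha (there (here refl) ∷ [])
            ; _ _ (there (here refl)) → arcs-within {h = h} (I ∷ O ∷ O ∷ I ∷ []) (O ∷ O ∷ O ∷ I ∷ []) r hfa (here refl ∷ []) })
       , s≤s (s≤s z≤n)
       , inj₁ (there (here refl)) ∷ inj₁ (here refl) ∷ []
       , here refl
    where
    open ClosedLayout (front ++ take 3 (octant r)) (take 1 (drop 3 (octant r))) (take 3 (drop 4 (octant r)))
      (split 3) (f a ∷ a ∷ []) V↭ refl cov t∈
    low : List (Config (5 + k) × Config (5 + k))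
    low = (at I O O I , f a) ∷ (at O O O I , a) ∷ []

  relabel : ∀ {p e e′} {L : List (Config (5 + k) × Config (5 + k))} → e ≡ e′ → (p , e′) ∈ L → (p , e) ∈ L
  relabel refl m = m

  -- A fork, without 2-cycles.

  module Fork {x y} (x≢y : x ≢ y) (fx≡fy : f x ≡ f y) (f-no2 : ∀ x → f (f x) ≢ x) where

    c z : Config (5 + k)
    c = f x
    z = f c

    B : List (Config (5 + k))
    B = y ∷ c ∷ z ∷ x ∷ []

    B-Unique : Unique B
    B-Unique = ((λ { refl → f-nofix y (sym fx≡fy) }) ∷ (λ { refl → f-no2 _ (cong f (sym fx≡fy)) }) ∷ (λ y≡x → x≢y (sym y≡x)) ∷ [])
             ∷ (≢-sym (f-nofix c) ∷ f-nofix x ∷ [])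
             ∷ (f-no2 x ∷ [])
             ∷ [] ∷ []

    -- q = f z lies outside {c, z}, the only elements whose place depends on the orientation.
    image-of-z : ∀ {R} → V ↭ B ++ R → f z ≡ x ⊎ f z ≡ y ⊎ f z ∈ R
    image-of-z V↭ = case ∈-++⁻ B (∈-resp-↭ V↭ (cube-complete (f z))) of λ where
      (inj₁ (here eq))                         → inj₂ (inj₁ eq)
      (inj₁ (there (here eq)))                 → contradiction eq (f-no2 c)
      (inj₁ (there (there (here eq))))         → contradiction eq (f-nofix z)
      (inj₁ (there (there (there (here eq))))) → inj₁ eq
      (inj₂ q∈)                                → inj₂ (inj₂ q∈)

    module _ (e : Bool → Bool → Config (5 + k)) where

      corners : Bool → List (Config (5 + k) × Config (5 + k))
      corners o = (e I I , y) ∷ (e O I , (if o then c else z)) ∷ (e I O , (if o then z else c)) ∷ (e O O , x) ∷ []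

      corners-elements : ∀ o → map proj₂ (corners o) ↭ B
      corners-elements true  = ↭-refl
      corners-elements false = prep y (swap z c ↭-refl)

      c-corner : ∀ o → (e (not o) o , c) ∈ corners o
      c-corner true  = there (here refl)
      c-corner false = there (there (here refl))

      z-corner : ∀ o → (e o (not o) , z) ∈ corners o
      z-corner true  = there (there (here refl))
      z-corner false = there (here refl)

      corner-fine : ∀ {P : Config (5 + k) → Set} o → P (e I I) → P (e (not o) o) → P (e o (not o)) → P (e O O) →
                    All (λ (s , _) → P s) (corners o)
      corner-fine true  py pc pz px = py ∷ pc ∷ pz ∷ px ∷ []
      corner-fine false py pc pz px = py ∷ pz ∷ pc ∷ px ∷ []

    module _ {R} (V↭ : V ↭ B ++ R) where

      open Bottom (front ++ take 3 (octant r)) (drop 4 (octant r)) (split 3)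

      private
        e = at-bottom

      module _ {ℓ R₁} (R↭ : R ↭ ℓ ∷ R₁) (leaf : Leaf R ℓ)
        (elements-↭ : (ℓ ∷ R₁) ++ B ↭ V) (π : Placement upper R₁ ℓ) where

        private
          M : List (Config (5 + k) × Config (5 + k))
          M = (ones (5 + k) , ℓ) ∷ Placement.pairs π

          z-image : ∃ λ q → (q , f z) ∈ M ⊎ (∀ o → (q , f z) ∈ corners e o)
          z-image = case image-of-z V↭ of λ where
            (inj₁ eq)         → e O O , inj₂ λ o → relabel eq (there (there (there (here refl))))
            (inj₂ (inj₁ eq))  → e I I , inj₂ λ o → relabel eq (here refl)
            (inj₂ (inj₂ q∈))  → let p , m = locate π (∈-resp-↭ R↭ q∈) in p , inj₁ m

        assemble-fork-leaf : ∀ q → (q , f z) ∈ M ⊎ (∀ o → (q , f z) ∈ corners e o) → Goal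
        assemble-fork-leaf q q-at =
          let o = orientation (suc zero) (suc (suc zero)) q in
          assemble π (corners e o) (proj₁ (AllPairs-++⁻ (_ ∷ upper) positions-Dn))
            (λ e∈ → leaf (∈-resp-↭ (↭-sym R↭) (there e∈))) positions-↭
            (↭-trans (++⁺ˡ (ℓ ∷ R₁) (corners-elements e o)) elements-↭) λ h resp →
            let open Attract h
                open Respects resp
                module S = Square at-bottom (suc zero) (suc (suc zero)) (λ _ _ → refl) (λ _ _ → refl) (λ _ _ → refl) (λ _ _ → refl) bottom-const h
                hx : h (e O O) ≡ e (not o) o
                hx = low-low (there (there (there (here refl)))) refl (c-corner e o)
                hy : h (e I I) ≡ e (not o) o
                hy = low-low (here refl) (sym fx≡fy) (c-corner e o)
                hc : h (e (not o) o) ≡ e o (not o)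
                hc = low-low (c-corner e o) refl (z-corner e o)
                hz : h (e o (not o)) ≡ q
                hz = case q-at of λ where
                  (inj₁ m) → low-M (z-corner e o) refl m
                  (inj₂ m) → low-low (z-corner e o) refl (m o)
            in e O O , e (not o) o ∷ e I I ∷ []
               , S.fork-linked o hx hy hc , S.fork-closed o hx hy hc , s≤s (s≤s (s≤s z≤n))
               , corner-fine e {P = Fine _} o (inj₁ (there (there (here refl)))) (inj₁ (there (here refl)))
                   (S.fork-fine (q) hz) (inj₁ (here refl))
               , λ {p} m m′ → inj₂ (inj₁ (subst (Dn p) (sym (M-low m refl m′))
                   (All.lookup (All.lookup (proj₂ (proj₂ (AllPairs-++⁻ (_ ∷ upper) positions-Dn)))
                     (position-∈ m)) (∈-map⁺ proj₁ m′))))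

        fork-leaf-placed : Goal
        fork-leaf-placed = assemble-fork-leaf (proj₁ z-image) (proj₂ z-image)

      fork-leaf : ∀ {ℓ} → ℓ ∈ R → Leaf R ℓ → Goal
      fork-leaf {ℓ} ℓ∈ leaf =
        let R₁ , R↭ = extract ℓ∈
            elements-↭ = ↭-sym (↭-trans V↭ (↭-trans (++⁺ˡ B R↭) (++-comm B (ℓ ∷ R₁))))
            u = Unique-resp-↭ R↭ (Unique-tail {B} V↭)
        in fork-leaf-placed R↭ leaf elements-↭
             -- With the square at 0 reserved, the end of the order has a single even position
             -- followed by four odd ones, which is the case of `solvable-five`.
             (solvable-zigzag {ps = at O O O I ∷ at I I I O ∷ at I O I O ∷ at I I O O ∷ at I O O O ∷ []}
               (solvable-five f-no2 {e = at O O O I} {ds = at I I I O ∷ at I O I O ∷ at I I O O ∷ at I O O O ∷ []}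
                 refl (refl ∷ refl ∷ refl ∷ refl ∷ []) refl)
               (ones (4 + k)) ((front ++ take 3 (octant r)) ++ (O ∷ O ∷ I ∷ r) ∷ []) R₁ ℓ
               (Unique-∷⁻ u) (upper-length upper R₁ {low = reserved} {low′ = B} positions-↭ elements-↭ refl)
               (λ ℓ∈₁ → contradiction ℓ∈₁ (Unique[x∷xs]⇒x∉xs u)))

    module _ {R t} (V↭ : V ↭ B ++ R) (cov : Covers R R) (t∈ : t ∈ R) where

      open ClosedLayout (front ++ take 2 (octant r)) (take 2 (drop 2 (octant r))) (take 3 (drop 4 (octant r)))
        (split 2) B V↭ refl cov t∈

      private
        e = at-middle

      open Middle (front ++ take 2 (octant r)) (take 2 (drop 2 (octant r))) (take 3 (drop 4 (octant r))) (split 2)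
        using (upper)

      module _ {u R₂} (fu : f u ≡ t) (R↭ : R ↭ t ∷ u ∷ R₂) (π : Placement upper R₂ t) where

        open Placed fu R↭ π

        private
          z-image : ∃ λ q → (q , f z) ∈ M ⊎ (∀ o → (q , f z) ∈ (at O O O O , u) ∷ corners e o)
          z-image = case image-of-z V↭ of λ where
            (inj₁ eq)         → e O O , inj₂ λ o → relabel eq (there (there (there (there (here refl)))))
            (inj₂ (inj₁ eq))  → e I I , inj₂ λ o → relabel eq (there (here refl))
            (inj₂ (inj₂ q∈)) → case position-of q∈ of λ where
              (inj₁ eq)      → at O O O O , inj₂ λ _ → relabel eq (here refl)
              (inj₂ (p , m)) → p , inj₁ m

        assemble-fork-closed : ∀ q → (q , f z) ∈ M ⊎ (∀ o → (q , f z) ∈ (at O O O O , u) ∷ corners e o) → Goal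
        assemble-fork-closed q q-at =
          let o = orientation zero (suc zero) q in
          assemble-closed (corners e o) refl (corners-elements e o) λ h resp →
            let open Attract h
                open Respects resp
                module S = Square at-middle zero (suc zero) (λ _ _ → refl) (λ _ _ → refl) (λ _ _ → refl) (λ _ _ → refl) middle-const h
                hx : h (e O O) ≡ e (not o) o
                hx = low-low (there (there (there (there (here refl))))) refl (there (c-corner e o))
                hy : h (e I I) ≡ e (not o) o
                hy = low-low (there (here refl)) (sym fx≡fy) (there (c-corner e o))
                hc : h (e (not o) o) ≡ e o (not o)
                hc = low-low (there (c-corner e o)) refl (there (z-corner e o))
                hz : h (e o (not o)) ≡ q
                hz = case q-at of λ where
                  (inj₁ m) → low-M (there (z-corner e o)) refl m
                  (inj₂ m) → low-low (there (z-corner e o)) refl (m o)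
            in e O O , e (not o) o ∷ e I I ∷ []
               , S.fork-linked o hx hy hc , S.fork-closed o hx hy hc , s≤s (s≤s (s≤s z≤n))
               , corner-fine e {P = Fine _} o (inj₁ (there (there (here refl)))) (inj₁ (there (here refl)))
                   (S.fork-fine (q) hz) (inj₁ (here refl))
               -- `e O O` is `at O O O I`, the target of the arc from 0.
               , here refl

        fork-closed-placed : Goal
        fork-closed-placed = assemble-fork-closed (proj₁ z-image) (proj₂ z-image)

      fork-closed-rest : Goal
      fork-closed-rest = place-rest fork-closed-placed

  -- A 4-cycle of a permutation.

  four-cycle-closed-rest : ∀ {x R t} → f (f (f (f x))) ≡ x →
    V ↭ (f x ∷ f (f (f x)) ∷ f (f x) ∷ x ∷ []) ++ R → Covers R R → t ∈ R → Goal
  four-cycle-closed-rest {x} f⁴x V↭ cov t∈ = place-rest λ fu R↭ π →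
    Placed.assemble-closed fu R↭ π low refl ↭-refl λ h resp →
    let open Attract h
        open Respects resp
        module S = Square at-middle zero (suc zero) (λ _ _ → refl) (λ _ _ → refl) (λ _ _ → refl) (λ _ _ → refl) middle-const h
        hx : h (e O O) ≡ e I I
        hx = low-low (there (there (there (there (here refl))))) refl (there (here refl))
        hc : h (e I I) ≡ e I O
        hc = low-low (there (here refl)) refl (there (there (there (here refl))))
        hz : h (e I O) ≡ e O I
        hz = low-low (there (there (there (here refl)))) refl (there (there (here refl)))
        hq : h (e O I) ≡ e O O
        hq = low-low (there (there (here refl))) f⁴x (there (there (there (there (here refl)))))
    in e I I , e I O ∷ e O O ∷ e O I ∷ []
       , S.four-cycle-linked hx hc hz hq , S.four-cycle-closed hx hc hz hq , s≤s (s≤s (s≤s (s≤s z≤n)))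
       , inj₁ (here refl) ∷ inj₁ (there (there (there (here refl)))) ∷ inj₁ (there (here refl))
         ∷ inj₁ (there (there (here refl))) ∷ []
       , there (there (here refl))
    where
    open ClosedLayout (front ++ take 2 (octant r)) (take 2 (drop 2 (octant r))) (take 3 (drop 4 (octant r)))
      (split 2) (f x ∷ f (f (f x)) ∷ f (f x) ∷ x ∷ []) V↭ refl cov t∈
    e = at-middle
    low : List (Config (5 + k) × Config (5 + k))
    low = (e I I , f x) ∷ (e O I , f (f (f x))) ∷ (e I O , f (f x)) ∷ (e O O , x) ∷ []

  -- Two disjoint paths of a permutation.

  find-true : ∀ {m} (p : Config m) → (∃ λ i → lookup p i ≡ true) ⊎ p ≡ zeros m
  find-true []          = inj₂ refl
  find-true (true ∷ p)  = inj₁ (zero , refl)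
  find-true (false ∷ p) with find-true p
  ... | inj₁ (i , pi) = inj₁ (suc i , pi)
  ... | inj₂ refl     = inj₂ refl

  -- The list holds the configurations below `at O I O I`, the position of `x`: exactly there a
  -- preimage of `x` would lack a decreasing arc.
  below-01 : ∀ (p : Config (5 + k)) → Dn p (at O I O I) ⊎
             p ∈ at O O O O ∷ at O I O O ∷ at O O O I ∷ at O I O I ∷ []
  below-01 (true ∷ p)             = inj₁ (zero , refl , refl)
  below-01 (_ ∷ _ ∷ true ∷ p)     = inj₁ (suc (suc zero) , refl , refl)
  below-01 (false ∷ a ∷ false ∷ b ∷ p) with find-true p
  ... | inj₁ (i , pi) = inj₁ (suc (suc (suc (suc i))) , pi , lookup-replicate i false)
  below-01 (false ∷ false ∷ false ∷ false ∷ .r) | inj₂ refl = inj₂ (here refl)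
  below-01 (false ∷ true  ∷ false ∷ false ∷ .r) | inj₂ refl = inj₂ (there (here refl))
  below-01 (false ∷ false ∷ false ∷ true  ∷ .r) | inj₂ refl = inj₂ (there (there (here refl)))
  below-01 (false ∷ true  ∷ false ∷ true  ∷ .r) | inj₂ refl = inj₂ (there (there (there (here refl))))

  -- The attractor x - c - d - y of two disjoint paths x → c → z and y → d → w of f,
  -- where z and w sit at the far corners of the squares at (x, c, d) and (c, d, y).
  module Six (h : F (5 + k)) where

    open Attract h

    path : List (Config (5 + k))
    path = at O I O I ∷ at O O O I ∷ at I O O I ∷ at I O I I ∷ []

    path-linked : h (at O I O I) ≡ at O O O I → h (at O O O I) ≡ at I I O I →
                  h (at I O O I) ≡ at O O I I → h (at I O I I) ≡ at I O O I → Linked _⇄_ path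
    path-linked hx hc hd hy =
      (arc hx (suc zero) (λ ()) , arc hc (suc zero) (λ ())) ∷
      (arc hc zero (λ ()) , arc hd zero (λ ())) ∷
      (arc hd (suc (suc zero)) (λ ()) , arc hy (suc (suc zero)) (λ ())) ∷ [-]

    path-closed : h (at O I O I) ≡ at O O O I → h (at O O O I) ≡ at I I O I →
                  h (at I O O I) ≡ at O O I I → h (at I O I I) ≡ at I O O I → Closed h (_∈ path)
    path-closed hx hc hd hy _ _ (here refl) =
      arcs-within {h = h} (O ∷ I ∷ O ∷ I ∷ []) (O ∷ O ∷ O ∷ I ∷ []) r hx (there (here refl) ∷ [])
    path-closed hx hc hd hy _ _ (there (here refl)) =
      arcs-within {h = h} (O ∷ O ∷ O ∷ I ∷ []) (I ∷ I ∷ O ∷ I ∷ []) r hc (there (there (here refl)) ∷ here refl ∷ [])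
    path-closed hx hc hd hy _ _ (there (there (here refl))) =
      arcs-within {h = h} (I ∷ O ∷ O ∷ I ∷ []) (O ∷ O ∷ I ∷ I ∷ []) r hd
        (there (here refl) ∷ there (there (there (here refl))) ∷ [])
    path-closed hx hc hd hy _ _ (there (there (there (here refl)))) =
      arcs-within {h = h} (I ∷ O ∷ I ∷ I ∷ []) (I ∷ O ∷ O ∷ I ∷ []) r hy (there (there (here refl)) ∷ [])

    -- Flipping bit 0 leads from the position of `w` to that of `y`, so any odd image will do.
    -- Dually, `z` sits at an odd position, so any even image gives a decreasing arc.
    w-fine : ∀ {q} → h (at O O I I) ≡ q → lookup q zero ≡ I → Fine path (at O O I I)
    w-fine hw q0 = inj₂ (inj₂ (_ , there (there (there (here refl)))
                        , arc hw zero (λ eq → contradiction (trans (sym q0) eq) λ ())))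

    z-fine : ∀ {q} → h (at I I O I) ≡ q → lookup q zero ≡ O → Fine path (at I I O I)
    z-fine hz q0 = inj₂ (inj₁ (zero , refl , trans (cong (λ q → lookup q zero) hz) q0))

  -- With two 3-cycles, `z` returns to `x` at an even position and `w` to `y` at an odd one, as
  -- `z-fine` and `w-fine` require.
  module _ {x y} (f³x : f (f (f x)) ≡ x) (f³y : f (f (f y)) ≡ y) where

    two-three-cycles : ∀ {R t} → V ↭ (y ∷ f (f y) ∷ f (f x) ∷ x ∷ f y ∷ f x ∷ []) ++ R →
                       Covers R R → t ∈ R → Goal
    two-three-cycles V↭ cov t∈ = place-rest λ fu R↭ π → Placed.assemble-closed fu R↭ π low refl ↭-refl λ h resp →
      let open Six h
          open Respects resp
          hx = low-low (there (there (there (there (here refl))))) refl (there (there (there (there (there (there (here refl)))))))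
          hc = low-low (there (there (there (there (there (there (here refl))))))) refl (there (there (there (here refl))))
          hz = low-low (there (there (there (here refl)))) f³x (there (there (there (there (here refl)))))
          hy = low-low (there (here refl)) refl (there (there (there (there (there (here refl))))))
          hd = low-low (there (there (there (there (there (here refl)))))) refl (there (there (here refl)))
          hw = low-low (there (there (here refl))) f³y (there (here refl))
      in _ , _ , path-linked hx hc hd hy , path-closed hx hc hd hy , s≤s (s≤s (s≤s (s≤s z≤n)))
         , inj₁ (there (there (there (here refl)))) ∷ w-fine hw refl ∷ z-fine hz refl
           ∷ inj₁ (here refl) ∷ inj₁ (there (there (here refl))) ∷ inj₁ (there (here refl)) ∷ []
         , there (here refl)
      where
      open ClosedLayout (front ++ take 1 (octant r)) (take 3 (drop 1 (octant r))) (take 3 (drop 4 (octant r)))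
        (split 1) (y ∷ f (f y) ∷ f (f x) ∷ x ∷ f y ∷ f x ∷ []) V↭ refl cov t∈
      low : List (Config (5 + k) × Config (5 + k))
      low = (at I O I I , y) ∷ (at O O I I , f (f y)) ∷ (at I I O I , f (f x))
          ∷ (at O I O I , x) ∷ (at I O O I , f y) ∷ (at O O O I , f x) ∷ []

  -- The path through `y` and `d` is extended at both ends. Its start `p` sits at 0 and maps to `y`
  -- at `at I O I I`, so 0 has an arc to `c` along bit 3. Its end `s` takes the top, an odd image
  -- for `w`; by injectivity `w`, which is reserved, is its only preimage.
  module LongCycle (f-inj : ∀ {x y} → f x ≡ f y → x ≡ y) (p x : Config (5 + k)) where

    y d w s c z : Config (5 + k)
    y = f p
    d = f y
    w = f d
    s = f w
    c = f x
    z = f c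

    open Middle (front ++ take 1 (octant r)) (take 3 (drop 1 (octant r))) (take 3 (drop 4 (octant r))) (split 1)

    D : List (Config (5 + k))
    D = p ∷ y ∷ w ∷ z ∷ x ∷ d ∷ c ∷ []

    low : List (Config (5 + k) × Config (5 + k))
    low = (at O O O O , p) ∷ (at I O I I , y) ∷ (at O O I I , w) ∷ (at I I O I , z)
        ∷ (at O I O I , x) ∷ (at I O O I , d) ∷ (at O O O I , c) ∷ []

    module _ {R} (V↭ : V ↭ (s ∷ D) ++ R) where

      elements-↭ : (s ∷ R) ++ D ↭ V
      elements-↭ = ↭-sym (↭-trans V↭ (prep s (++-comm D R)))

      apart : ∀ {e} → e ∈ s ∷ R → e ∉ D
      apart = disjoint {D} (↭-trans (↭-sym elements-↭) (++-comm (s ∷ R) D))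

      assemble-long : (π : Placement upper R s) →
        f z ≡ x ⊎ (∃ λ q → (q , f z) ∈ Placement.pairs π × lookup q zero ≡ O) → Goal
      assemble-long π z-image = assemble π low (proj₁ (AllPairs-++⁻ (_ ∷ upper) (positions-Dn)))
        (λ e∈ fe → apart (there e∈) (subst (_∈ D) (sym (f-inj fe)) (there (there (here refl)))))
        positions-↭ elements-↭ λ h resp →
        let open Attract h
            open Six h
            open Respects resp
            h0 = low-low (here refl) refl (there (here refl))
            hx = low-low (there (there (there (there (here refl))))) refl (there (there (there (there (there (there (here refl)))))))
            hc = low-low (there (there (there (there (there (there (here refl))))))) refl (there (there (there (here refl))))
            hy = low-low (there (here refl)) refl (there (there (there (there (there (here refl))))))
            hd = low-low (there (there (there (there (there (here refl)))))) refl (there (there (here refl)))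
            hw = low-M (there (there (here refl))) refl (here refl)
            z-ok : Fine path (at I I O I)
            z-ok = case z-image of λ where
              (inj₁ fz)           → z-fine (low-low (there (there (there (here refl)))) fz (there (there (there (there (here refl)))))) refl
              (inj₂ (q , m , q0)) → z-fine (low-M (there (there (there (here refl)))) refl (there m)) q0
            no-hit : ∀ {q e e′} {A : Set} → (q , e) ∈ _ → f e ≡ f e′ → e′ ∈ D → A
            no-hit m fe e′∈ = contradiction (subst (_∈ D) (sym (f-inj fe)) e′∈) (apart (element-∈ m))
            hit-x : ∀ {q e} → (q , e) ∈ _ → f e ≡ x → Fine path q
            hit-x {q} m fe =
              let hq = M-low m fe (there (there (there (there (here refl)))))
                  q∉ = λ q∈ → disjoint {_ ∷ upper} (↭-sym positions-↭) q∈ (position-∈ m)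
              in case below-01 q of λ where
                (inj₁ dn) → inj₂ (inj₁ (subst (Dn q) (sym hq) dn))
                (inj₂ (here refl))                         → contradiction (here refl) q∉
                -- `at O I O O` is the only position below that of `x` which is not reserved, and
                -- flipping bit 3 leads from it to `x` itself.
                (inj₂ (there (here refl)))                 → inj₂ (inj₂ (_ , here refl , arc hq (suc (suc (suc zero))) (λ ())))
                (inj₂ (there (there (here refl))))         → contradiction (there (there (there (there (there (there (here refl)))))) ) q∉
                (inj₂ (there (there (there (here refl))))) → contradiction (there (there (there (there (here refl))))) q∉
            hit : ∀ {q e t} → (q , e) ∈ _ → (t , f e) ∈ low → Fine path q
            hit {q} m m′ = case m′ of λ where
              (here eq) → inj₂ (inj₁ (subst (Dn q) (sym (M-low m (cong proj₂ eq) (here refl)))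
                (All.lookup (All.lookup (proj₂ (proj₂ (AllPairs-++⁻ (_ ∷ upper) positions-Dn)))
                  (position-∈ m)) (here refl))))
              (there (here eq))                                         → no-hit m (cong proj₂ eq) (here refl)
              (there (there (here eq)))                                 → no-hit m (cong proj₂ eq) (there (there (there (there (there (here refl))))))
              (there (there (there (here eq))))                         → no-hit m (cong proj₂ eq) (there (there (there (there (there (there (here refl)))))))
              (there (there (there (there (here eq)))))                 → hit-x m (cong proj₂ eq)
              (there (there (there (there (there (here eq))))))         → no-hit m (cong proj₂ eq) (there (here refl))
              (there (there (there (there (there (there (here eq))))))) → no-hit m (cong proj₂ eq) (there (there (there (there (here refl)))))
        in _ , _ , path-linked hx hc hd hy , path-closed hx hc hd hy , s≤s (s≤s (s≤s (s≤s z≤n)))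
           , inj₂ (inj₂ (_ , there (here refl) , arc h0 (suc (suc (suc zero))) (λ ())))
             ∷ inj₁ (there (there (there (here refl)))) ∷ w-fine hw refl ∷ z-ok
             ∷ inj₁ (here refl) ∷ inj₁ (there (there (here refl))) ∷ inj₁ (there (here refl)) ∷ []
           , hit

      three-cycle-and-long : f z ≡ x → Goal
      three-cycle-and-long fz = assemble-long
        (solvable-zigzag₀ (ones (4 + k)) _ R s (Unique-tail {s ∷ D} V↭)
          (upper-length upper R {low = reserved} {low′ = D} positions-↭ elements-↭ refl)
          (λ s∈ → contradiction (here refl) (disjoint {s ∷ D} V↭ s∈)))
        (inj₁ fz)

    -- The first pair below the top is filled by hand. The even position goes to `f z`, as `z-fine`
    -- asks; its only preimage `z` is reserved. The odd one goes to the image of `f z`, whose only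
    -- preimage has just been placed above it.
    two-long-paths : ∀ {R} → V ↭ (s ∷ D) ++ f z ∷ f (f z) ∷ R → Goal
    two-long-paths {R} V↭ = assemble-long V↭
      (place (at′ false (ones (4 + k))) q ↭-refl π₁
        (λ m fe → contradiction (f-inj fe) λ { refl → disjoint {s ∷ D} V↭ (there (Placement.element-∈ π₁ m)) z∈ })
        (λ q≡s → contradiction q≡s (q≢s (here refl)))
        (λ m → contradiction refl (q≢s (there (Placement.element-∈ π₁ m)))))
      (inj₂ (_ , here refl , refl))
      where
      q : Config (5 + k)
      q = f z
      at′ : Bool → Config (4 + k) → Config (5 + k)
      at′ b v = b ∷ v
      z∈ : z ∈ s ∷ D
      z∈ = there (there (there (there (here refl))))
      uR : Unique (q ∷ f q ∷ R)
      uR = Unique-tail {s ∷ D} V↭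
      q≢s : ∀ {e} → e ∈ q ∷ f q ∷ R → e ≢ s
      q≢s e∈ refl = disjoint {s ∷ D} V↭ e∈ (here refl)
      rest : List (Config (4 + k))
      rest = ((vs₀ ++ take 1 (octant r)) ++ take 3 (drop 4 (octant r))) ++ zeros (4 + k) ∷ []
      π₀ : Placement (zigzag v₀ rest) R s
      π₀ = solvable-zigzag₀ v₀ rest R s (Unique-∷⁻ (Unique-∷⁻ uR))
             (suc-injective (suc-injective (upper-length upper (q ∷ f q ∷ R) {low = reserved} {low′ = D}
               positions-↭ (elements-↭ V↭) refl)))
             (λ s∈ → contradiction refl (q≢s (there (there s∈))))
      π₁ : Placement (at′ true v₀ ∷ zigzag v₀ rest) (f q ∷ R) s
      π₁ = place (at′ true v₀) (f q) ↭-refl π₀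
             (λ m fe → contradiction (f-inj fe) λ { refl →
               Unique[x∷xs]⇒x∉xs uR (there (Placement.element-∈ π₀ m)) })
             (λ _ → refl) (Placement.orphan π₀)

  -- Case distinction by the cycles of `f`.

  iter : ℕ → Config (5 + k) → Config (5 + k)
  iter zero    a = a
  iter (suc i) a = f (iter i a)

  V-large : 10 ≤ length V
  V-large =
    let w , ws , eq = cube-cons k
    in subst (λ l → 10 ≤ length (double (double (double (double (double l)))))) (sym eq) (m≤m+n 10 _)
    where
    cube-cons : ∀ n → ∃ λ w → ∃ λ ws → cube n ≡ w ∷ ws
    cube-cons zero    = [] , [] , refl
    cube-cons (suc n) = let w , ws , eq = cube-cons n in _ , _ , cong double eq

  open DecMembership _≟ᶜ_ using (_∈?_)

  -- The bound nine is that of the longest list to be avoided, the chain in `long-cycles`.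
  fresh : ∀ D → length D ≤ 9 → ∃ λ t → t ∉ D
  fresh D short with any? (λ t → ¬? (t ∈? D)) V
  ... | yes new = let t , _ , t∉ = find new in t , t∉
  ... | no ¬new = contradiction (≤-trans V-large (≤-trans
    (⊆-Unique⇒length≤ (cube-Unique (5 + k)) λ {x} x∈ → decidable-stable (x ∈? D) λ x∉ → ¬new (lose x∈ x∉)) short))
    (<⇒≱ (n<1+n 9))

  remove : ∀ D → Unique D → ∃ λ R → V ↭ D ++ R
  remove D u = complement D u λ {x} _ → cube-complete x

  outside : ∀ {D R t} → V ↭ D ++ R → t ∉ D → t ∈ R
  outside {D} {t = t} V↭ t∉ = case ∈-++⁻ D (∈-resp-↭ V↭ (cube-complete t)) of λ where
    (inj₁ t∈) → contradiction t∈ t∉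
    (inj₂ t∈) → t∈

  two-cycle : ∀ {a} → f (f a) ≡ a → Goal
  two-cycle {a} ffa with R , V↭ ← remove (f a ∷ a ∷ []) ((f-nofix a ∷ []) ∷ [] ∷ []) with leaf-or-covers R R
  ... | inj₁ (ℓ , ℓ∈ , leaf) = two-cycle-leaf ffa V↭ ℓ∈ leaf
  ... | inj₂ cov = two-cycle-closed ffa V↭ cov
                     (outside V↭ (proj₂ (fresh (f a ∷ a ∷ []) (s≤s (s≤s z≤n)))))

  fork : ∀ {x y} → x ≢ y → f x ≡ f y → (∀ x → f (f x) ≢ x) → Goal
  fork x≢y fx≡fy f-no2 = go (remove B B-Unique)
    where
    open Fork x≢y fx≡fy f-no2
    go : (∃ λ R → V ↭ B ++ R) → Goal
    go (R , V↭) with leaf-or-covers R R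
    ... | inj₁ (ℓ , ℓ∈ , leaf) = fork-leaf V↭ ℓ∈ leaf
    ... | inj₂ cov = fork-closed-rest V↭ cov
                       (outside V↭ (proj₂ (fresh B (s≤s (s≤s (s≤s (s≤s z≤n)))))))

  module Permutation (f-inj : ∀ {x y} → f x ≡ f y → x ≡ y) (f-no2 : ∀ x → f (f x) ≢ x) where

    -- Every element of `D` already has its preimage in `D`, so by injectivity nothing enters `D`
    -- from outside; an injective self-map of the finite remainder is onto.
    rest-covers-itself : ∀ {D R} → V ↭ D ++ R → Covers D D → Covers R R
    rest-covers-itself {D} {R} V↭ cov = injective⇒covers (Unique-tail {D} V↭) closed λ _ _ → f-inj
      where
      closed : ∀ {e} → e ∈ R → f e ∈ R
      closed e∈ = outside V↭ λ fe∈ → let b , b∈ , eq = cov fe∈ in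
        disjoint {D} V↭ e∈ (subst (_∈ D) (f-inj eq) b∈)

    iter-∉ : ∀ {D a} → Covers D D → a ∉ D → ∀ i → iter i a ∉ D
    iter-∉ cov a∉ zero    = a∉
    iter-∉ {D} cov a∉ (suc i) m = let b , b∈ , eq = cov m in
      iter-∉ cov a∉ i (subst (_∈ D) (f-inj eq) b∈)

    -- Distinctness is proved in the order of iteration, `E`, and carried over to the order of the
    -- layout, `D`.
    remove-↭ : ∀ {E : List (Config (5 + k))} → Unique E → ∀ D → All (_∈ D) E → length D ≤ length E →
               (∀ R → V ↭ D ++ R → Goal) → Goal
    remove-↭ u D E⊆D le goal =
      let R , V↭ = remove D (Unique-resp-↭ (⊆-Unique⇒↭ u (All.lookup E⊆D) le) u) in goal R V↭

    four-cycle : ∀ {x} → f (f (f (f x))) ≡ x → Goal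
    four-cycle {x} f⁴x = remove-↭ unique D (All.tabulate λ e∈ → e∈) ≤-refl λ R V↭ →
      four-cycle-closed-rest f⁴x V↭ (rest-covers-itself V↭ cov)
        (outside V↭ (proj₂ (fresh D (s≤s (s≤s (s≤s (s≤s z≤n)))))))
      where
      D : List (Config (5 + k))
      D = f x ∷ f (f (f x)) ∷ f (f x) ∷ x ∷ []
      unique : Unique D
      unique = (≢-sym (f-no2 (f x)) ∷ ≢-sym (f-nofix (f x)) ∷ f-nofix x ∷ [])
             ∷ (f-nofix (f (f x)) ∷ (λ f³x → f-nofix x (trans (sym (cong f f³x)) f⁴x)) ∷ [])
             ∷ (f-no2 x ∷ []) ∷ [] ∷ []
      cov : Covers D D
      cov (here refl)                         = x , there (there (there (here refl))) , refl
      cov (there (here refl))                 = f (f x) , there (there (here refl)) , refl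
      cov (there (there (here refl)))         = f x , here refl , refl
      cov (there (there (there (here refl)))) = f (f (f x)) , there (here refl) , f⁴x

    Aperiodic : ℕ → Config (5 + k) → Set
    Aperiodic m a = ∀ d → suc d < m → iter (suc d) a ≢ a

    iter-cancel : ∀ i {a b} → iter i a ≡ iter i b → a ≡ b
    iter-cancel zero    eq = eq
    iter-cancel (suc i) eq = iter-cancel i (f-inj eq)

    iter-+ : ∀ i j a → iter (i + j) a ≡ iter i (iter j a)
    iter-+ zero    j a = refl
    iter-+ (suc i) j a = cong f (iter-+ i j a)

    chain : ℕ → Config (5 + k) → List (Config (5 + k))
    chain m a = applyUpTo (λ i → iter i a) m

    -- Equal iterates with indices `i < j` cancel to a return of `a` after `j - i` steps, fewer than
    -- `m`.
    chain-Unique : ∀ m {a} → Aperiodic m a → Unique (chain m a)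
    chain-Unique m {a} ap = applyUpTo⁺₁ _ m λ {i} {j} i<j j<m eq →
      let d , i+d≡j = m≤n⇒∃[o]m+o≡n i<j
          i+1+d≡j   = trans (+-suc i d) i+d≡j
      in ap d (≤-<-trans (m≤n+m (suc d) i) (subst (_< m) (sym i+1+d≡j) j<m))
           (sym (iter-cancel i (trans eq (trans (cong (λ j → iter j a) (sym i+1+d≡j)) (iter-+ i (suc d) a)))))

    triple : Config (5 + k) → List (Config (5 + k))
    triple x = f (f x) ∷ x ∷ f x ∷ []

    module _ {x} (f³x : f (f (f x)) ≡ x) where

      private
        triple-Covers : Covers (triple x) (triple x)
        triple-Covers (here refl)                 = f x , there (there (here refl)) , refl
        triple-Covers (there (here refl))         = f (f x) , here refl , f³x
        triple-Covers (there (there (here refl))) = x , there (here refl) , refl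

      chain-∉-triple : ∀ {p} m → p ∉ triple x → ∀ {e} → ¬ (e ∈ chain m p × e ∈ triple x)
      chain-∉-triple {p} m p∉ (e∈ , e∈′) with i , _ , refl ← ∈-applyUpTo⁻ (λ i → iter i p) e∈ =
        iter-∉ triple-Covers p∉ i e∈′

      triple-period : ∀ {e} → e ∈ triple x → f (f (f e)) ≡ e
      triple-period (here refl)                 = cong (λ a → f (f a)) f³x
      triple-period (there (here refl))         = f³x
      triple-period (there (there (here refl))) = cong f f³x

    triple-Unique : ∀ x → Unique (triple x)
    triple-Unique x = (f-no2 x ∷ f-nofix (f x) ∷ []) ∷ (≢-sym (f-nofix x) ∷ []) ∷ [] ∷ []

    -- Having no return within four steps, `p` has five distinct iterates. They avoid the cycle of
    -- `x`, all of whose points return after three steps.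
    three-cycle-with-long : (∀ x → f (f (f (f x))) ≢ x) →
      ∀ p x → f (f (f x)) ≡ x → f (f (f p)) ≢ p → Goal
    three-cycle-with-long f-no4 p x f³x f³p = remove-↭
      (Unique.++⁺ (chain-Unique 5 aperiodic) (triple-Unique x)
        (chain-∉-triple f³x 5 λ p∈ → f³p (triple-period f³x p∈)))
      (s ∷ D) members ≤-refl λ R V↭ → three-cycle-and-long V↭ f³x
      where
      open LongCycle f-inj p x using (s; D; three-cycle-and-long)
      aperiodic : Aperiodic 5 p
      aperiodic 0 _ = f-nofix p
      aperiodic 1 _ = f-no2 p
      aperiodic 2 _ = f³p
      aperiodic 3 _ = f-no4 p
      aperiodic (suc (suc (suc (suc _)))) (s≤s (s≤s (s≤s (s≤s (s≤s ())))))
      members : All (_∈ s ∷ D) (chain 5 p ++ triple x)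
      members = there (here refl) ∷ there (there (here refl))
        ∷ there (there (there (there (there (there (here refl))))))
        ∷ there (there (there (here refl))) ∷ here refl
        ∷ there (there (there (there (here refl)))) ∷ there (there (there (there (there (here refl)))))
        ∷ there (there (there (there (there (there (there (here refl))))))) ∷ []

    three-cycle-pair : ∀ x y → f (f (f x)) ≡ x → f (f (f y)) ≡ y → y ∉ triple x → Goal
    three-cycle-pair x y f³x f³y y∉ = remove-↭ (Unique.++⁺ (triple-Unique y) (triple-Unique x) apart) D
      (there (here refl) ∷ here refl ∷ there (there (there (there (here refl))))
        ∷ there (there (here refl)) ∷ there (there (there (here refl)))
        ∷ there (there (there (there (there (here refl))))) ∷ []) ≤-refl λ R V↭ →
      two-three-cycles f³x f³y V↭ (rest-covers-itself V↭ cov)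
        (outside V↭ (proj₂ (fresh D (s≤s (s≤s (s≤s (s≤s (s≤s (s≤s z≤n)))))))))
      where
      D : List (Config (5 + k))
      D = y ∷ f (f y) ∷ f (f x) ∷ x ∷ f y ∷ f x ∷ []
      apart : ∀ {e} → ¬ (e ∈ triple y × e ∈ triple x)
      apart (here refl                 , e∈) = chain-∉-triple f³x 3 y∉ (there (there (here refl)) , e∈)
      apart (there (here refl)         , e∈) = chain-∉-triple f³x 3 y∉ (here refl , e∈)
      apart (there (there (here refl)) , e∈) = chain-∉-triple f³x 3 y∉ (there (here refl) , e∈)
      cov : Covers D D
      cov (here refl)                                         = f (f y) , there (here refl) , f³y
      cov (there (here refl))                                 = f y , there (there (there (there (here refl)))) , refl
      cov (there (there (here refl)))                         = f x , there (there (there (there (there (here refl))))) , refl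
      cov (there (there (there (here refl))))                 = f (f x) , there (there (here refl)) , f³x
      cov (there (there (there (there (here refl)))))         = y , here refl , refl
      cov (there (there (there (there (there (here refl)))))) = x , there (there (there (here refl))) , refl

    three-cycle : (∀ x → f (f (f (f x))) ≢ x) → ∀ {x} → f (f (f x)) ≡ x → Goal
    three-cycle f-no4 {x} f³x with any? (λ p → ¬? (f (f (f p)) ≟ᶜ p)) V
    ... | yes long = let p , _ , f³p = find long in three-cycle-with-long f-no4 p x f³x f³p
    ... | no ¬long =
      let y , y∉ = fresh (triple x) (s≤s (s≤s (s≤s z≤n)))
          f³y    = decidable-stable (f (f (f y)) ≟ᶜ y) λ neq → ¬long (lose (cube-complete y) neq)
      in three-cycle-pair x y f³x f³y y∉

    -- A common point `iter i p = iter j x` has `i` at most 4 and equals `iter (j + 4) b`.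
    -- Cancelling `i` steps puts `p` on the chain of `b` at index `j + 4 - i`, below 9. The head
    -- start of 4 keeps that index from being negative, even if both chains lie on one cycle.
    two-chains : (∀ x → f (f (f x)) ≢ x) → (∀ x → f (f (f (f x))) ≢ x) →
                 ∀ b p x → x ≡ iter 4 b → p ∉ chain 9 b → Goal
    two-chains f-no3 f-no4 b p x x≡ p∉ = remove-↭
      (Unique.++⁺ (chain-Unique 5 aperiodic) (chain-Unique 5 aperiodic) apart) E members ≤-refl
      λ R V↭ → two-long-paths V↭
      where
      open LongCycle f-inj p x using (s; D; z; two-long-paths)
      aperiodic : ∀ {a} → Aperiodic 5 a
      aperiodic 0 _ = f-nofix _
      aperiodic 1 _ = f-no2 _
      aperiodic 2 _ = f-no3 _
      aperiodic 3 _ = f-no4 _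
      aperiodic (suc (suc (suc (suc _)))) (s≤s (s≤s (s≤s (s≤s (s≤s ())))))
      apart : ∀ {e} → ¬ (e ∈ chain 5 p × e ∈ chain 5 x)
      apart (e∈ , e∈′) =
        let i , i<5 , e≡  = ∈-applyUpTo⁻ (λ i → iter i p) e∈
            j , j<5 , e≡′ = ∈-applyUpTo⁻ (λ j → iter j x) e∈′
            d , i+d≡j+4 = m≤n⇒∃[o]m+o≡n (≤-trans (s≤s⁻¹ i<5) (m≤n+m 4 j))
            p≡ = iter-cancel i (trans (sym e≡) (trans e≡′ (trans (cong (iter j) x≡) (trans (sym (iter-+ j 4 b))
                   (trans (cong (λ l → iter l b) (sym i+d≡j+4)) (iter-+ i d b))))))
        in p∉ (subst (_∈ chain 9 b) (sym p≡)
             (∈-applyUpTo⁺ (λ i → iter i b)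
               (≤-<-trans (m≤n+m d i) (subst (_< 9) (sym i+d≡j+4) (+-monoˡ-< 4 j<5)))))
      E : List (Config (5 + k))
      E = (s ∷ D) ++ f z ∷ f (f z) ∷ []
      members : All (_∈ E) (chain 5 p ++ chain 5 x)
      members = there (here refl) ∷ there (there (here refl))
        ∷ there (there (there (there (there (there (here refl))))))
        ∷ there (there (there (here refl))) ∷ here refl
        ∷ there (there (there (there (there (here refl)))))
        ∷ there (there (there (there (there (there (there (here refl)))))))
        ∷ there (there (there (there (here refl))))
        ∷ there (there (there (there (there (there (there (there (here refl))))))))
        ∷ there (there (there (there (there (there (there (there (there (here refl))))))))) ∷ []

    long-cycles : (∀ x → f (f (f x)) ≢ x) → (∀ x → f (f (f (f x))) ≢ x) → Goal
    long-cycles f-no3 f-no4 =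
      let b , _  = fresh [] z≤n
          p , p∉ = fresh (chain 9 b) ≤-refl
      in two-chains f-no3 f-no4 b p (iter 4 b) refl p∉

  -- The order of the cases matters. A fork is treated without 2-cycles and all later cases for a
  -- permutation without them; excluding 4-cycles before 3-cycles gives every point off the 3-cycles
  -- five distinct iterates.
  solution : Goal
  solution with any? (λ a → f (f a) ≟ᶜ a) V
  ... | yes two = two-cycle (proj₂ (proj₂ (find two)))
  ... | no ¬two with any? (λ x → any? (λ y → ¬? (x ≟ᶜ y) ×-dec (f x ≟ᶜ f y)) V) V
  ...   | yes noninj =
    let _ , _ , some = find noninj
        _ , _ , x≢y , fx≡fy = find some
    in fork x≢y fx≡fy λ a eq → ¬two (lose (cube-complete a) eq)
  ...   | no inj = go (any? (λ a → f (f (f (f a))) ≟ᶜ a) V) (any? (λ a → f (f (f a)) ≟ᶜ a) V)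
    where
    open Permutation
      (λ {x} {y} eq → decidable-stable (x ≟ᶜ y) λ x≢y →
        inj (lose (cube-complete x) (lose (cube-complete y) (x≢y , eq))))
      (λ a eq → ¬two (lose (cube-complete a) eq))
    go : Dec _ → Dec _ → Goal
    go (yes four) _           = four-cycle (proj₂ (proj₂ (find four)))
    go (no ¬four) (yes three) = three-cycle (λ a eq → ¬four (lose (cube-complete a) eq)) (proj₂ (proj₂ (find three)))
    go (no ¬four) (no ¬three) = long-cycles (λ a eq → ¬three (lose (cube-complete a) eq))
                                            (λ a eq → ¬four (lose (cube-complete a) eq))

theorem8 : (n : ℕ) → 5 ≤ n → (f : F n) → (∀ x → f x ≢ x) →
    Σ (F n) λ h → (h ∼ f) × Σ (List (Config n)) λ A →
    IsAttractor h A × (length A ≤ 4)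
    × (∀ x → ∃ λ a → (a ∈ A) × AlmostDecPath h x a)
theorem8 _ (s≤s (s≤s (s≤s (s≤s (s≤s {n = k} z≤n))))) f f-nofix = Network.solution k f f-nofix
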